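{- Let $p$ be a prime and let $\Gamma\subseteq\mathbb{F}_p^*$ be a multiplicative subgroup with $|\Gamma|\ge c\,\frac{(\log\log p)^2}{\sqrt{\log p}}\,p$ for some fixed constant $c>0$. Then $$\mathrm{sf}(\Gamma)\le\Big(\frac13+o(1)\Big)|\Gamma|,$$ where $o(1)\to0$ as $p\to\infty$.
   Context: $\mathrm{sf}(\Gamma)$ is the maximal size of a subset $S\subseteq\Gamma$ with no solution to $x+y=z$, $x,y,z\in S$ (addition in $\mathbb{F}_p$). -}

module Defs where

open import Data.Nat using (ℕ; _+_; _*_; _^_)
open import Data.Fin using (Fin; toℕ; zero; suc)
open import Data.Fin.Subset using (Subset; _∈_; _∉_)
open import Data.Product using (Σ; ∃; _×_)
open import Relation.Binary.PropositionalEquality using (_≡_)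
open import Relation.Nullary using (¬_)
open import Data.Nat.Logarithm using (⌊log₂_⌋)

-- Elements of 𝔽_p are represented by Fin p (residues 0,…,p-1).
-- x + y = z in 𝔽_p  (exact since all residues are < p)
AddEq : (p : ℕ) → Fin p → Fin p → Fin p → Set
AddEq p x y z = ∃ λ k → toℕ x + toℕ y ≡ toℕ z + k * p

MulEq : (p : ℕ) → Fin p → Fin p → Fin p → Set
MulEq p x y z = ∃ λ k → toℕ x * toℕ y ≡ toℕ z + k * p

record IsMulSubgroup (p : ℕ) (Γ : Subset p) : Set where
  field
    one∈   : ∃ λ (o : Fin p) → (toℕ o ≡ 1) × (o ∈ Γ)
    zero∉  : ∀ (x : Fin p) → toℕ x ≡ 0 → x ∉ Γ
    mul∈   : ∀ x y z → x ∈ Γ → y ∈ Γ → MulEq p x y z → z ∈ Γ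
    inv∈   : ∀ x → x ∈ Γ → ∃ λ y → (y ∈ Γ) × ∃ λ (o : Fin p) → (toℕ o ≡ 1) × MulEq p x y o

SumFree : (p : ℕ) → Subset p → Set
SumFree p S = ¬ (∃ λ x → ∃ λ y → ∃ λ z → (x ∈ S) × (y ∈ S) × (z ∈ S) × AddEq p x y z)

-- L(p) = ⌊log₂ p⌋ and LL(p) = ⌊log₂ ⌊log₂ p⌋⌋ (stand-ins for log p, log log p)
L : ℕ → ℕ
L p = ⌊log₂ p ⌋

LL : ℕ → ℕ
LL p = ⌊log₂ ⌊log₂ p ⌋ ⌋

{-# OPTIONS --safe #-}
-- Suppose S ⊆ Γ is sum-free with |S| ≥ (1/3 + 1/m)|Γ|, and let p ≤ q|S|.  By sampling k ≍ q²
-- elements of S (Croot–Sisask) one finds w = 1_H, |H| ≥ p / 2qᵏ, whose elements h nearly fix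
-- 1_S ∗ 1_S in L².  Since q² log q = o(log p), the set H is large enough for Γ to be equidistributed
-- on most of its translates: the variance is invariant under dilation by Γ, and over all dilates of
-- H two points of H give independent translates of Γ.  Hence N(x) = |S ∩ (x + H)| is essentially
-- bounded by |Γ||H|/p, so {x : N(x) ≥ |Γ||H|/(3m p)} has density above 1/3, and by Pollard's theorem
-- it contains ≫ p² triples x + y = z.  Thus ∑ N(x) N(y) N(x + y) is large; but by almost periodicity
-- it is close to a multiple of the number of solutions of x + y = z in S, which is zero.
module Submission where

-- The sample size is forced by the final comparison. Up to constants depending on m, Pollard's
-- theorem bounds the smoothed count below by |Γ|³|H|³/p, while sum-freeness and k samples bound it
-- above by |S|²|H|³/√k. These conflict once √k exceeds a large multiple of q, whence k ≍ q². The
-- set H then loses a factor qᵏ, and the second-moment estimate for Γ needs |H| ≫ q²; so everything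
-- rests on q^(k+2) ≪ p, which is the condition on q² log q.
--
-- Almost periodicity is used without a cutoff. Each k-tuple from S is rewarded by C minus its
-- error, and the rewards are added along an orbit of diagonal translations. A positive total makes
-- H large and bounds the average error over all of H. Taking the best point of the orbit as its
-- origin makes the shift 0 good too; this ties 1_S ∗ 1_S itself to the common approximant.
--
-- Probabilities, quotients and square roots are avoided: denominators are cleared, expectations are
-- sums over all tuples, and Cauchy-Schwarz appears as an AM-GM inequality with a free parameter, so
-- that all estimates are polynomial inequalities over ℤ.

-- Finite sums and 0/1-valued functions over the integers.

module IntegerSums where

  open import Algebra.Bundles using (CommutativeSemiring)
  open import Data.Fin.Base using (Fin; zero; suc)
  open import Data.Fin.Permutation using (permutation)
  open import Data.Fin.Properties as Fin using (any?)
  open import Data.Integer hiding (suc)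
  open import Data.Integer.Properties
  import Data.Nat.Base as ℕ
  open import Data.Product.Base using (∃; _,_; _×_)
  open import Data.Sum.Base using (_⊎_; inj₁; inj₂)
  open import Function.Base using (_∘_)
  open import Relation.Binary.PropositionalEquality
  open import Relation.Nullary using (yes; no; contradiction)
  open import Relation.Nullary.Decidable using (_×-dec_; ¬?)
  open import Algebra.Properties.Semiring.Sum
    (CommutativeSemiring.semiring +-*-commutativeSemiring) public
    using (∑-comm)
    renaming (sum to ∑; sum-cong-≗ to ∑-cong; ∑-distrib-+ to ∑-+)
  open import Algebra.Properties.Semiring.Sum
    (CommutativeSemiring.semiring +-*-commutativeSemiring)
    using (sum-permute; *-distribˡ-sum)

  private variable
    n : ℕ.ℕ
    a b c d : ℤ

  0≤+ : 0ℤ ≤ a → 0ℤ ≤ b → 0ℤ ≤ a + b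
  0≤+ = +-mono-≤

  *-monoˡ : 0ℤ ≤ c → a ≤ b → c * a ≤ c * b
  *-monoˡ {+ k} _ a≤b = *-monoˡ-≤-nonNeg (+ k) a≤b

  *-monoʳ : 0ℤ ≤ c → a ≤ b → a * c ≤ b * c
  *-monoʳ {+ k} _ a≤b = *-monoʳ-≤-nonNeg (+ k) a≤b

  *-mono : 0ℤ ≤ a → 0ℤ ≤ d → a ≤ b → c ≤ d → a * c ≤ b * d
  *-mono 0≤a 0≤d a≤b c≤d = ≤-trans (*-monoˡ 0≤a c≤d) (*-monoʳ 0≤d a≤b)

  0≤* : 0ℤ ≤ a → 0ℤ ≤ b → 0ℤ ≤ a * b
  0≤* {a} {b} 0≤a 0≤b = subst (_≤ a * b) (*-zeroʳ a) (*-monoˡ 0≤a 0≤b)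

  0<* : 0ℤ < a → 0ℤ < b → 0ℤ < a * b
  0<* {a} {b} 0<a 0<b = subst (_< a * b) (*-zeroʳ a) (*-monoˡ-<-pos a {{positive 0<a}} 0<b)

  0<ʳ : 0ℤ ≤ a → 0ℤ < a * b → 0ℤ < b
  0<ʳ {a} {b} 0≤a 0<ab = ≰⇒> λ b≤0 → <⇒≱ 0<ab (subst (a * b ≤_) (*-zeroʳ a) (*-monoˡ 0≤a b≤0))

  0<ˡ : 0ℤ ≤ b → 0ℤ < a * b → 0ℤ < a
  0<ˡ {b} {a} 0≤b 0<ab = 0<ʳ 0≤b (subst (0ℤ <_) (*-comm a b) 0<ab)

  0<^ : ∀ k → 0ℤ < a → 0ℤ < a ^ k
  0<^ ℕ.zero    _   = +<+ (ℕ.s≤s ℕ.z≤n)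
  0<^ (ℕ.suc k) 0<a = 0<* 0<a (0<^ k 0<a)

  0≤^ : ∀ k → 0ℤ ≤ a → 0ℤ ≤ a ^ k
  0≤^ ℕ.zero    _   = +≤+ ℕ.z≤n
  0≤^ (ℕ.suc k) 0≤a = 0≤* 0≤a (0≤^ k 0≤a)

  sq : ℤ → ℤ
  sq a = a * a

  0≤sq : ∀ a → 0ℤ ≤ a * a
  0≤sq (+ k)    = 0≤* {+ k} (+≤+ ℕ.z≤n) (+≤+ ℕ.z≤n)
  0≤sq -[1+ k ] = +≤+ ℕ.z≤n

  difference : a ≤ b → 0ℤ ≤ b - a
  difference = i≤j⇒0≤j-i

  -- The standard route to an inequality below: exhibit b - a as an expression that is visibly
  -- nonnegative from the hypotheses, and leave the identity to the ring solver.
  by-difference : 0ℤ ≤ c → b - a ≡ c → a ≤ b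
  by-difference {c} 0≤c e = 0≤i-j⇒j≤i (subst (0ℤ ≤_) (sym e) 0≤c)

  cancelˡ-≤ : 0ℤ < c → c * a ≤ c * b → a ≤ b
  cancelˡ-≤ {+[1+ k ]} _ = *-cancelˡ-≤-pos _ _ +[1+ k ]
  cancelˡ-≤ {+0} (+<+ ())

  ∑-mono : {f g : Fin n → ℤ} → (∀ x → f x ≤ g x) → ∑ f ≤ ∑ g
  ∑-mono {n = ℕ.zero}  _   = ≤-refl
  ∑-mono {n = ℕ.suc _} f≤g = +-mono-≤ (f≤g zero) (∑-mono (f≤g ∘ suc))

  ∑-const : ∀ c → ∑ {n} (λ _ → c) ≡ + n * c
  ∑-const {ℕ.zero}  c = sym (*-zeroˡ c)
  ∑-const {ℕ.suc n} c = trans (cong (_+_ c) (∑-const {n} c)) (sym (suc-* (+ n) c))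

  ∑-0 : {f : Fin n → ℤ} → (∀ x → f x ≡ 0ℤ) → ∑ f ≡ 0ℤ
  ∑-0 {n} f≡0 = trans (∑-cong f≡0) (trans (∑-const {n} 0ℤ) (*-zeroʳ (+ n)))

  ∑-nonneg : {f : Fin n → ℤ} → (∀ x → 0ℤ ≤ f x) → 0ℤ ≤ ∑ f
  ∑-nonneg {n} {f} 0≤f = subst (_≤ ∑ f) (∑-0 {n} λ _ → refl) (∑-mono 0≤f)

  ∑-*ˡ : ∀ c (f : Fin n → ℤ) → ∑ (λ x → c * f x) ≡ c * ∑ f
  ∑-*ˡ c f = sym (*-distribˡ-sum c f)

  ∑-*ʳ : ∀ c (f : Fin n → ℤ) → ∑ (λ x → f x * c) ≡ ∑ f * c
  ∑-*ʳ c f = trans (∑-cong (λ x → *-comm (f x) c)) (trans (∑-*ˡ c f) (*-comm c (∑ f)))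

  ∑-- : (f g : Fin n → ℤ) → ∑ (λ x → f x - g x) ≡ ∑ f - ∑ g
  ∑-- f g = trans (∑-+ f (λ x → - g x)) (cong (_+_ (∑ f))
    (trans (∑-cong (λ x → sym (-1*i≡-i (g x)))) (trans (∑-*ˡ -1ℤ g) (-1*i≡-i (∑ g)))))

  ∑-* : ∀ {m} (f : Fin m → ℤ) (g : Fin n → ℤ) → ∑ f * ∑ g ≡ ∑ λ x → ∑ λ y → f x * g y
  ∑-* f g = trans (sym (∑-*ʳ (∑ g) f)) (∑-cong λ x → sym (∑-*ˡ (f x) g))

  ∑-bijection : (h h⁻¹ : Fin n → Fin n) → (∀ x → h (h⁻¹ x) ≡ x) → (∀ x → h⁻¹ (h x) ≡ x) →
                ∀ f → ∑ (f ∘ h) ≡ ∑ f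
  ∑-bijection h h⁻¹ hh⁻¹ h⁻¹h f = sym (sum-permute f (permutation h h⁻¹ hh⁻¹ h⁻¹h))

  ∑-single : ∀ {f : Fin n → ℤ} y → (∀ x → x ≢ y → f x ≡ 0ℤ) → ∑ f ≡ f y
  ∑-single {f = f} zero    f≡0 =
    trans (cong (_+_ (f zero)) (∑-0 λ x → f≡0 (suc x) λ ())) (+-identityʳ _)
  ∑-single {f = f} (suc y) f≡0 =
    trans (cong₂ _+_ (f≡0 zero λ ()) (∑-single y λ x x≢y → f≡0 (suc x) (x≢y ∘ Fin.suc-injective)))
          (+-identityˡ _)

  ∑-≥-term : {f : Fin n → ℤ} → (∀ x → 0ℤ ≤ f x) → ∀ y → f y ≤ ∑ f
  ∑-≥-term {f = f} 0≤f zero =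
    subst (_≤ ∑ f) (+-identityʳ (f zero)) (+-monoʳ-≤ (f zero) (∑-nonneg (0≤f ∘ suc)))
  ∑-≥-term {f = f} 0≤f (suc y) = ≤-trans (∑-≥-term (0≤f ∘ suc) y)
    (subst (_≤ ∑ f) (+-identityˡ (∑ (f ∘ suc))) (+-monoˡ-≤ (∑ (f ∘ suc)) (0≤f zero)))

  -- Pigeonhole without division; the index argument witnesses that the range is nonempty.
  ∑-≤-max : Fin n → ∀ (f : Fin n → ℤ) → ∃ λ y → ∑ f ≤ + n * f y
  ∑-≤-max {ℕ.suc n} _ f = let y , f≤ = argmax f in
    y , subst (∑ f ≤_) (∑-const {ℕ.suc n} (f y)) (∑-mono f≤)
    where
    argmax : ∀ {n} (f : Fin (ℕ.suc n) → ℤ) → ∃ λ y → ∀ x → f x ≤ f y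
    argmax {ℕ.zero}  f = zero , λ where zero → ≤-refl
    argmax {ℕ.suc n} f with argmax (f ∘ suc)
    ... | y , f≤ with ≤-total (f zero) (f (suc y))
    ...   | inj₁ f0≤fy = suc y , λ where zero → f0≤fy ; (suc x) → f≤ x
    ...   | inj₂ fy≤f0 = zero , λ where zero → ≤-refl ; (suc x) → ≤-trans (f≤ x) fy≤f0

  -- Sets are carried as integer-valued indicators, so that cardinalities, intersections and
  -- convolutions are all sums and products in ℤ.
  Bit : ℤ → Set
  Bit z = z ≡ 0ℤ ⊎ z ≡ 1ℤ

  Bits : (Fin n → ℤ) → Set
  Bits f = ∀ x → Bit (f x)

  bit-* : Bit a → Bit b → Bit (a * b)
  bit-* {b = b} (inj₁ refl) _         = inj₁ (*-zeroˡ b)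
  bit-* {b = b} (inj₂ refl) b∈        = subst Bit (sym (*-identityˡ b)) b∈

  bit-idem : Bit a → a * a ≡ a
  bit-idem (inj₁ refl) = refl
  bit-idem (inj₂ refl) = refl

  bit-≥0 : Bit a → 0ℤ ≤ a
  bit-≥0 (inj₁ refl) = ≤-refl
  bit-≥0 (inj₂ refl) = +≤+ ℕ.z≤n

  bit-≤1 : Bit a → a ≤ 1ℤ
  bit-≤1 (inj₁ refl) = +≤+ ℕ.z≤n
  bit-≤1 (inj₂ refl) = ≤-refl

  ∑-1 : ∑ {n} (λ _ → 1ℤ) ≡ + n
  ∑-1 {n} = trans (∑-const {n} 1ℤ) (*-identityʳ (+ n))

  ∑-bits-≤ : {f : Fin n → ℤ} → Bits f → ∑ f ≤ + n
  ∑-bits-≤ {n} {f} f∈ = subst (∑ f ≤_) (∑-1 {n}) (∑-mono (λ x → bit-≤1 (f∈ x)))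

  bits-member : {f : Fin n → ℤ} → Bits f → 0ℤ < ∑ f → ∃ λ x → f x ≡ 1ℤ
  bits-member {f = f} f∈ 0<∑ with any? (λ x → f x ≟ 1ℤ)
  ... | yes found = found
  ... | no none = contradiction (sym (∑-0 λ x → zero-at x)) (<⇒≢ 0<∑)
    where
    zero-at : ∀ x → f x ≡ 0ℤ
    zero-at x with f∈ x
    ... | inj₁ e = e
    ... | inj₂ e = contradiction (x , e) none

  bits-nonmember : {f : Fin n → ℤ} → Bits f → ∑ f < + n → ∃ λ x → f x ≡ 0ℤ
  bits-nonmember {n} {f = f} f∈ ∑<n with any? (λ x → f x ≟ 0ℤ)
  ... | yes found = found
  ... | no none = contradiction (trans (∑-cong one-at) (∑-1 {n})) (<⇒≢ ∑<n)
    where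
    one-at : ∀ x → f x ≡ 1ℤ
    one-at x with f∈ x
    ... | inj₁ e = contradiction (x , e) none
    ... | inj₂ e = e

  bits-another : {f : Fin n → ℤ} → Bits f → 1ℤ < ∑ f → ∀ y → ∃ λ x → f x ≡ 1ℤ × x ≢ y
  bits-another {f = f} f∈ 1<∑ y with any? (λ x → (f x ≟ 1ℤ) ×-dec ¬? (x Fin.≟ y))
  ... | yes found = found
  ... | no none = contradiction (subst (_≤ 1ℤ) (sym (∑-single y zero-off)) (bit-≤1 (f∈ y))) (<⇒≱ 1<∑)
    where
    zero-off : ∀ x → x ≢ y → f x ≡ 0ℤ
    zero-off x x≢y with f∈ x
    ... | inj₁ e = e
    ... | inj₂ e = contradiction (x , e , x≢y) none

-- Arithmetic of the prime field on `Fin p`.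

module PrimeFields where

  open import Algebra.Core using (Op₁; Op₂)
  open import Algebra.Bundles using (CommutativeRing)
  open import Algebra.Structures using (IsCommutativeRing)
  import Algebra.Solver.Ring as RingSolver
  open import Algebra.Solver.Ring.AlmostCommutativeRing using (fromCommutativeRing; _-Raw-AlmostCommutative⟶_)
  open import Data.Fin.Base using (Fin; toℕ; fromℕ<)
  open import Data.Fin.Properties using (toℕ-injective; toℕ-fromℕ<; toℕ<n)
  open import Data.Integer hiding (suc; _⊖_; _/_; NonZero)
  open import Data.Integer.DivMod using (_%ℕ_; _/ℕ_; n%ℕd<d; a≡a%ℕn+[a/ℕn]*n)
  open import Data.Integer.Properties
  open import Data.Integer.Tactic.RingSolver using (solve-∀)
  import Data.Maybe.Base as Maybe
  open import Data.Nat.Base as ℕ using (ℕ; suc; NonZero)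
  import Data.Nat.Properties as ℕ
  open import Data.Nat.DivMod using (_/_; m≡m%n+[m/n]*n)
  open import Data.Nat.Coprimality using (prime⇒coprime; coprime-Bézout)
  open import Data.Nat.GCD using (module Bézout)
  open import Data.Nat.Primality using (Prime)
  open import Data.Product.Base using (∃; _,_)
  open import Function.Base using (_∋_)
  open import Level using (0ℓ)
  open import Relation.Binary.PropositionalEquality
  open import Relation.Nullary using (contradiction)
  open import Relation.Nullary.Decidable using (dec⇒maybe)

  -- An abstract interface: the later modules see only the ring laws and `residue`, and never unfold
  -- reduction modulo p.
  record PrimeField (p : ℕ) : Set where
    infixl 6 _⊕_ _⊖_
    infixl 7 _⊗_
    infix  8 ⊝_
    field
      _⊕_ _⊗_           : Op₂ (Fin p)
      ⊝_                : Op₁ (Fin p)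
      𝟎 𝟏               : Fin p
      isCommutativeRing : IsCommutativeRing _≡_ _⊕_ _⊗_ ⊝_ 𝟎 𝟏
      residue           : ℤ → Fin p
      residue-+         : ∀ i j → residue (i + j) ≡ residue i ⊕ residue j
      residue-*         : ∀ i j → residue (i * j) ≡ residue i ⊗ residue j
      residue-neg       : ∀ i → residue (- i) ≡ ⊝ residue i
      residue-0         : residue 0ℤ ≡ 𝟎
      residue-1         : residue 1ℤ ≡ 𝟏
      residue-toℕ       : ∀ x → residue (+ toℕ x) ≡ x
      residue-p         : residue (+ p) ≡ 𝟎
      residue-mod       : ∀ m → ∃ λ k → m ≡ toℕ (residue (+ m)) ℕ.+ k ℕ.* p
      inverse           : ∀ x → x ≢ 𝟎 → ∃ λ y → x ⊗ y ≡ 𝟏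

    _⊖_ : Op₂ (Fin p)
    x ⊖ y = x ⊕ ⊝ y

    commutativeRing : CommutativeRing 0ℓ 0ℓ
    commutativeRing = record { isCommutativeRing = isCommutativeRing }

    residue-morphism : CommutativeRing.rawRing +-*-commutativeRing
                       -Raw-AlmostCommutative⟶ fromCommutativeRing commutativeRing
    residue-morphism = record
      { ⟦_⟧ = residue ; +-homo = residue-+ ; *-homo = residue-* ; -‿homo = residue-neg
      ; 0-homo = residue-0 ; 1-homo = residue-1 }

    -- The solver takes integer coefficients. Its `con 0ℤ` and `con 1ℤ` denote `residue 0ℤ` and
    -- `residue 1ℤ`, which equal `𝟎` and `𝟏` only propositionally; hence the rewrites by `residue-0`
    -- and `residue-1` around later calls.
    open RingSolver _ _ residue-morphism (λ i j → Maybe.map (cong residue) (dec⇒maybe (i ≟ j)))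
      public using (solve; _:=_; _:+_; _:*_; _:-_; :-_; con)

  module _ (p : ℕ) .{{_ : NonZero p}} where

    private
      ρ : ℤ → Fin p
      ρ i = fromℕ< (n%ℕd<d i p)

      ι : Fin p → ℤ
      ι x = + toℕ x

      quot : ℤ → ℤ
      quot i = i /ℕ p

      ρ-spec : ∀ i → ι (ρ i) + quot i * + p ≡ i
      ρ-spec i = trans (cong (λ r → + r + quot i * + p) (toℕ-fromℕ< (n%ℕd<d i p)))
                       (sym (a≡a%ℕn+[a/ℕn]*n i p))

      too-large : ∀ {x y : Fin p} {c} → toℕ x ≢ toℕ y ℕ.+ suc c ℕ.* p
      too-large {x} {y} {c} e = ℕ.<⇒≱ (toℕ<n x) (subst (p ℕ.≤_) (sym e)
        (ℕ.≤-trans (ℕ.m≤m+n p (c ℕ.* p)) (ℕ.m≤n+m (suc c ℕ.* p) (toℕ y))))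

    -- Both representatives lie below p, so no nonzero multiple of p separates them; a negative
    -- multiple is moved to the other side.
    ι-injective-mod : ∀ {x y} c → ι x ≡ ι y + c * + p → x ≡ y
    ι-injective-mod {x} {y} +0 e = toℕ-injective (+-injective (trans e
      (((∀ a b → a + 0ℤ * b ≡ a) ∋ solve-∀) (ι y) (+ p))))
    ι-injective-mod {x} {y} +[1+ c ] e = contradiction (+-injective (trans e
      (cong (_+_ (ι y)) (sym (pos-* (suc c) p))))) (too-large {x} {y} {c})
    ι-injective-mod {x} {y} -[1+ c ] e = contradiction (+-injective
      (trans (flip-side (ι x) (ι y) +[1+ c ] (+ p) e) (cong (_+_ (ι x)) (sym (pos-* (suc c) p)))))
      (too-large {y} {x} {c})
      where
      flip-side : ∀ a b c q → a ≡ b + (- c) * q → b ≡ a + c * q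
      flip-side _ b c q refl = ((∀ b c q → b ≡ b + (- c) * q + c * q) ∋ solve-∀) b c q

    ρ-cong : ∀ i j c → i ≡ j + c * + p → ρ i ≡ ρ j
    ρ-cong i j c e = ι-injective-mod (c + quot j - quot i)
      (aux (ι (ρ i)) (ι (ρ j)) (quot i) (quot j) c (+ p)
           (trans (ρ-spec i) (trans e (cong (_+ c * + p) (sym (ρ-spec j))))))
      where
      aux : ∀ x y a b c q → x + a * q ≡ y + b * q + c * q → x ≡ y + (c + b - a) * q
      aux x y a b c q e = trans (((∀ x a q → x ≡ x + a * q - a * q) ∋ solve-∀) x a q)
        (trans (cong (_- a * q) e)
          (((∀ y b c a q → y + b * q + c * q - a * q ≡ y + (c + b - a) * q) ∋ solve-∀) y b c a q))

    ρ-ι : ∀ x → ρ (ι x) ≡ x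
    ρ-ι x = ι-injective-mod (- quot (ι x)) (aux (ι (ρ (ι x))) (quot (ι x)) (+ p) (ρ-spec (ι x)))
      where
      aux : ∀ a b q {z} → a + b * q ≡ z → a ≡ z + (- b) * q
      aux a b q refl = ((∀ a b q → a ≡ a + b * q + (- b) * q) ∋ solve-∀) a b q

    infixl 6 _+ₚ_
    infixl 7 _*ₚ_
    _+ₚ_ _*ₚ_ : Op₂ (Fin p)
    x +ₚ y = ρ (ι x + ι y)
    x *ₚ y = ρ (ι x * ι y)

    -ₚ_ : Op₁ (Fin p)
    -ₚ x = ρ (- ι x)

    private
      ρ-+ : ∀ i j → ρ (i + j) ≡ ρ i +ₚ ρ j
      ρ-+ i j = ρ-cong (i + j) (ι (ρ i) + ι (ρ j)) (quot i + quot j) (trans (cong₂ _+_ (sym (ρ-spec i)) (sym (ρ-spec j)))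
        (((∀ a b c d q → a + b * q + (c + d * q) ≡ a + c + (b + d) * q) ∋ solve-∀)
          (ι (ρ i)) (quot i) (ι (ρ j)) (quot j) (+ p)))

      ρ-* : ∀ i j → ρ (i * j) ≡ ρ i *ₚ ρ j
      ρ-* i j = ρ-cong (i * j) (ι (ρ i) * ι (ρ j)) (ι (ρ i) * quot j + quot i * ι (ρ j) + quot i * quot j * + p)
        (trans (cong₂ _*_ (sym (ρ-spec i)) (sym (ρ-spec j)))
        (((∀ a b c d q → (a + b * q) * (c + d * q) ≡ a * c + (a * d + b * c + b * d * q) * q) ∋ solve-∀)
          (ι (ρ i)) (quot i) (ι (ρ j)) (quot j) (+ p)))

      ρ-neg : ∀ i → ρ (- i) ≡ -ₚ ρ i
      ρ-neg i = ρ-cong (- i) (- ι (ρ i)) (- quot i) (trans (cong (-_) (sym (ρ-spec i)))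
        (((∀ a b q → - (a + b * q) ≡ - a + (- b) * q) ∋ solve-∀) (ι (ρ i)) (quot i) (+ p)))

      -- Lets each ring law be checked on residues of integers, where it follows from ℤ because `ρ`
      -- is a homomorphism.
      ρ-surjective : (P : Fin p → Set) → (∀ i → P (ρ i)) → ∀ x → P x
      ρ-surjective P Pρ x = subst P (ρ-ι x) (Pρ (ι x))

      +-assocₚ : ∀ x y z → (x +ₚ y) +ₚ z ≡ x +ₚ (y +ₚ z)
      +-assocₚ = ρ-surjective _ λ i → ρ-surjective _ λ j → ρ-surjective _ λ k →
        trans (cong (_+ₚ ρ k) (sym (ρ-+ i j))) (trans (sym (ρ-+ (i + j) k))
        (trans (cong ρ (+-assoc i j k)) (trans (ρ-+ i (j + k)) (cong (ρ i +ₚ_) (ρ-+ j k)))))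

      *-assocₚ : ∀ x y z → (x *ₚ y) *ₚ z ≡ x *ₚ (y *ₚ z)
      *-assocₚ = ρ-surjective _ λ i → ρ-surjective _ λ j → ρ-surjective _ λ k →
        trans (cong (_*ₚ ρ k) (sym (ρ-* i j))) (trans (sym (ρ-* (i * j) k))
        (trans (cong ρ (*-assoc i j k)) (trans (ρ-* i (j * k)) (cong (ρ i *ₚ_) (ρ-* j k)))))

      +-commₚ : ∀ x y → x +ₚ y ≡ y +ₚ x
      +-commₚ x y = cong ρ (+-comm (ι x) (ι y))

      *-commₚ : ∀ x y → x *ₚ y ≡ y *ₚ x
      *-commₚ x y = cong ρ (*-comm (ι x) (ι y))

      +-identityˡₚ : ∀ x → ρ 0ℤ +ₚ x ≡ x
      +-identityˡₚ = ρ-surjective _ λ i → trans (sym (ρ-+ 0ℤ i)) (cong ρ (+-identityˡ i))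

      *-identityˡₚ : ∀ x → ρ 1ℤ *ₚ x ≡ x
      *-identityˡₚ = ρ-surjective _ λ i → trans (sym (ρ-* 1ℤ i)) (cong ρ (*-identityˡ i))

      +-inverseˡₚ : ∀ x → (-ₚ x) +ₚ x ≡ ρ 0ℤ
      +-inverseˡₚ = ρ-surjective _ λ i → trans (cong (_+ₚ ρ i) (sym (ρ-neg i)))
        (trans (sym (ρ-+ (- i) i)) (cong ρ (+-inverseˡ i)))

      distribˡₚ : ∀ x y z → x *ₚ (y +ₚ z) ≡ x *ₚ y +ₚ x *ₚ z
      distribˡₚ = ρ-surjective _ λ i → ρ-surjective _ λ j → ρ-surjective _ λ k →
        trans (cong (ρ i *ₚ_) (sym (ρ-+ j k))) (trans (sym (ρ-* i (j + k)))
        (trans (cong ρ (*-distribˡ-+ i j k))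
        (trans (ρ-+ (i * j) (i * k)) (cong₂ _+ₚ_ (ρ-* i j) (ρ-* i k)))))

      comm⇒ʳ : ∀ {_∙_ : Op₂ (Fin p)} {e f : Fin p → Fin p} →
               (∀ x y → x ∙ y ≡ y ∙ x) → (∀ x → f x ∙ x ≡ e x) → ∀ x → x ∙ f x ≡ e x
      comm⇒ʳ {f = f} comm l x = trans (comm x (f x)) (l x)

      isCommutativeRingₚ : IsCommutativeRing _≡_ _+ₚ_ _*ₚ_ -ₚ_ (ρ 0ℤ) (ρ 1ℤ)
      isCommutativeRingₚ = record
        { isRing = record
          { +-isAbelianGroup = record
            { isGroup = record
              { isMonoid = record
                { isSemigroup = record
                  { isMagma = isMagma _+ₚ_
                  ; assoc = +-assocₚ }
                ; identity = +-identityˡₚ , comm⇒ʳ +-commₚ +-identityˡₚ }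
              ; inverse = +-inverseˡₚ , comm⇒ʳ +-commₚ +-inverseˡₚ
              ; ⁻¹-cong = cong -ₚ_ }
            ; comm = +-commₚ }
          ; *-cong = cong₂ _*ₚ_
          ; *-assoc = *-assocₚ
          ; *-identity = *-identityˡₚ , comm⇒ʳ *-commₚ *-identityˡₚ
          ; distrib = distribˡₚ , λ x y z → trans (*-commₚ (y +ₚ z) x)
              (trans (distribˡₚ x y z) (cong₂ _+ₚ_ (*-commₚ x y) (*-commₚ x z))) }
        ; *-comm = *-commₚ }
        where open import Relation.Binary.PropositionalEquality.Algebra using (isMagma)

      inverseₚ : Prime p → ∀ x → x ≢ ρ 0ℤ → ∃ λ y → x *ₚ y ≡ ρ 1ℤ
      inverseₚ p-prime x x≢0 = from-Bézout (coprime-Bézout (prime⇒coprime p-prime {{toℕ≢0}} (toℕ<n x)))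
        where
        toℕ≢0 : NonZero (toℕ x)
        toℕ≢0 = ℕ.≢-nonZero λ e → x≢0 (trans (sym (ρ-ι x)) (cong (λ n → ρ (+ n)) e))

        x*ρ : ∀ i → x *ₚ ρ i ≡ ρ (ι x * i)
        x*ρ i = trans (cong (_*ₚ ρ i) (sym (ρ-ι x))) (sym (ρ-* (ι x) i))

        from-Bézout : Bézout.Identity 1 p (toℕ x) → ∃ λ y → x *ₚ y ≡ ρ 1ℤ
        from-Bézout (Bézout.-+ a b e) = ρ (+ b) , trans (x*ρ (+ b)) (ρ-cong (ι x * + b) 1ℤ (+ a)
          (trans (*-comm (ι x) (+ b)) (trans (sym (pos-* b (toℕ x)))
            (trans (cong +_ (sym e)) (cong (_+_ 1ℤ) (pos-* a p))))))
        -- Here Bézout reads 1 + b x = a p, so the inverse is the residue of -b.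
        from-Bézout (Bézout.+- a b e) = ρ (- + b) , trans (x*ρ (- + b)) (ρ-cong (ι x * (- + b)) 1ℤ (- + a)
          (aux (ι x) (+ b) (+ a * + p) (+ a) (+ p) refl
            (trans (cong (_+_ 1ℤ) (sym (pos-* b (toℕ x)))) (trans (cong +_ e) (pos-* a p)))))
          where
          aux : ∀ x b c a q → c ≡ a * q → 1ℤ + b * x ≡ c → x * (- b) ≡ 1ℤ + (- a) * q
          aux x b _ a q refl e = trans (((∀ x b → x * (- b) ≡ 1ℤ - (1ℤ + b * x)) ∋ solve-∀) x b)
            (trans (cong (_-_ 1ℤ) e) (((∀ a q → 1ℤ - a * q ≡ 1ℤ + (- a) * q) ∋ solve-∀) a q))

    primeField : Prime p → PrimeField p
    primeField p-prime = record
      { _⊕_ = _+ₚ_ ; _⊗_ = _*ₚ_ ; ⊝_ = -ₚ_ ; 𝟎 = ρ 0ℤ ; 𝟏 = ρ 1ℤ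
      ; isCommutativeRing = isCommutativeRingₚ
      ; residue = ρ ; residue-+ = ρ-+ ; residue-* = ρ-* ; residue-neg = ρ-neg
      ; residue-0 = refl ; residue-1 = refl ; residue-toℕ = ρ-ι
      ; residue-p = ρ-cong (+ p) 0ℤ 1ℤ (sym (trans (+-identityˡ (1ℤ * + p)) (*-identityˡ (+ p))))
      ; residue-mod = λ m → m / p , trans (m≡m%n+[m/n]*n m p)
          (cong (ℕ._+ m / p ℕ.* p) (sym (toℕ-fromℕ< (n%ℕd<d (+ m) p))))
      ; inverse = inverseₚ p-prime }

-- Pollard's theorem and the counting of Schur triples.

module Pollard {p} (F : PrimeFields.PrimeField p) where

  open PrimeFields.PrimeField F
  open IntegerSums
  open import Data.Fin.Base using (Fin; toℕ)
  open import Data.Integer hiding (suc; _⊖_)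
  open import Data.Integer.Properties
  open import Data.Integer.Tactic.RingSolver using (solve-∀) renaming (solve to ring)
  open import Data.List.Base using (_∷_; [])
  open import Data.Nat.Base as ℕ using (ℕ; suc; zero)
  open import Data.Product.Base using (∃; _×_; _,_; proj₁; proj₂)
  open import Data.Sum.Base using (inj₁; inj₂)
  open import Function.Base using (_∘_; _∋_)
  open import Relation.Binary.PropositionalEquality
  open import Relation.Nullary using (yes; no; contradiction)

  private
    P : ℤ
    P = + p

  ∑-shift : ∀ h f → ∑ (λ x → f (x ⊕ h)) ≡ ∑ f
  ∑-shift h = ∑-bijection (_⊕ h) (_⊖ h)
    (λ x → solve 2 (λ x h → (x :- h) :+ h := x) refl x h)
    (λ x → solve 2 (λ x h → (x :+ h) :- h := x) refl x h)

  ∑-reflect : ∀ c f → ∑ (λ x → f (c ⊖ x)) ≡ ∑ f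
  ∑-reflect c = ∑-bijection (c ⊖_) (c ⊖_) reflect² reflect²
    where
    reflect² : ∀ x → c ⊖ (c ⊖ x) ≡ x
    reflect² x = solve 2 (λ c x → c :- (c :- x) := x) refl c x

  conv : (Fin p → ℤ) → (Fin p → ℤ) → Fin p → ℤ
  conv a b z = ∑ λ x → a x * b (z ⊖ x)

  conv-comm : ∀ a b z → conv a b z ≡ conv b a z
  conv-comm a b z = trans (sym (∑-reflect z _)) (∑-cong λ x →
    trans (cong (λ y → a (z ⊖ x) * b y) (solve 2 (λ z x → z :- (z :- x) := x) refl z x))
          (*-comm (a (z ⊖ x)) (b x)))

  conv-≥0 : ∀ {a b} → Bits a → Bits b → ∀ z → 0ℤ ≤ conv a b z
  conv-≥0 a∈ b∈ z = ∑-nonneg λ x → 0≤* (bit-≥0 (a∈ x)) (bit-≥0 (b∈ (z ⊖ x)))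

  conv-≤ : ∀ {a b} → Bits a → Bits b → ∀ z → conv a b z ≤ ∑ b
  conv-≤ {a} {b} a∈ b∈ z = subst (conv a b z ≤_) (∑-reflect z b) (∑-mono λ x →
    subst (a x * b (z ⊖ x) ≤_) (*-identityˡ (b (z ⊖ x)))
      (*-monoʳ (bit-≥0 (b∈ (z ⊖ x))) (bit-≤1 (a∈ x))))

  ∑-conv : ∀ a b → ∑ (conv a b) ≡ ∑ a * ∑ b
  ∑-conv a b = trans (∑-comm (λ z x → a x * b (z ⊖ x)))
    (trans (∑-cong λ x → trans (∑-*ˡ (a x) (λ z → b (z ⊖ x))) (cong (a x *_) (∑-shift (⊝ x) b)))
           (∑-*ʳ (∑ b) a))

  conv-shift : ∀ a b c z → conv a (λ x → b (x ⊖ c)) z ≡ conv a b (z ⊖ c)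
  conv-shift a b c z = ∑-cong λ x → cong (λ y → a x * b y)
    (solve 3 (λ z x c → z :- x :- c := z :- c :- x) refl z x c)

  -- The Dyson transform: with i the indicator of A ∩ B, the pairs of A × B are traded for
  -- those of (A ∪ B) × (A ∩ B) and (A ∖ B) × (B ∖ A).
  module Dyson (a b : Fin p → ℤ) where
    i u a′ b′ : Fin p → ℤ
    i x = a x * b x
    u x = a x + b x - i x
    a′ x = a x - i x
    b′ x = b x - i x

    -- Pointwise, a(x) b(z - x) exceeds the sum of the two new products by i(x) b′(z - x) - b′(x)
    -- i(z - x), and this sums to zero by commutativity of convolution.
    conv-split : ∀ z → conv a b z ≡ conv u i z + conv a′ b′ z
    conv-split z = trans (∑-cong λ x → split (a x) (b x) (a (z ⊖ x)) (b (z ⊖ x)))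
      (trans (∑-+ {p} _ _) (trans (cong₂ _+_ (∑-+ {p} _ _) (trans (∑-- {p} _ _)
        (cong (_- conv b′ i z) (conv-comm i b′ z))))
      (cancel (conv u i z) (conv a′ b′ z) (conv b′ i z))))
      where
      split : ∀ a b c d → a * d ≡ (a + b - a * b) * (c * d) + (a - a * b) * (d - c * d)
                                  + (a * b * (d - c * d) - (b - a * b) * (c * d))
      split = solve-∀
      cancel : ∀ x y z → x + y + (z - z) ≡ x + y
      cancel = solve-∀

    ∑u : ∑ u ≡ ∑ a + ∑ b - ∑ i
    ∑u = trans (∑-- (λ x → a x + b x) i) (cong (_- ∑ i) (∑-+ a b))

    ∑a′ : ∑ a′ ≡ ∑ a - ∑ i
    ∑a′ = ∑-- a i

    ∑b′ : ∑ b′ ≡ ∑ b - ∑ i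
    ∑b′ = ∑-- b i

    module _ (a∈ : Bits a) (b∈ : Bits b) where

      i∈ : Bits i
      i∈ x = bit-* (a∈ x) (b∈ x)

      private
        bit-∨ : ∀ {a b} → Bit a → Bit b → Bit (a + b - a * b)
        bit-∨ (inj₁ refl) (inj₁ refl) = inj₁ refl
        bit-∨ (inj₁ refl) (inj₂ refl) = inj₂ refl
        bit-∨ (inj₂ refl) (inj₁ refl) = inj₂ refl
        bit-∨ (inj₂ refl) (inj₂ refl) = inj₂ refl

        bit-∖ : ∀ {a b} → Bit a → Bit b → Bit (a - a * b)
        bit-∖ (inj₁ refl) (inj₁ refl) = inj₁ refl
        bit-∖ (inj₁ refl) (inj₂ refl) = inj₁ refl
        bit-∖ (inj₂ refl) (inj₁ refl) = inj₂ refl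
        bit-∖ (inj₂ refl) (inj₂ refl) = inj₁ refl

      u∈ : Bits u
      u∈ x = bit-∨ (a∈ x) (b∈ x)

      a′∈ : Bits a′
      a′∈ x = bit-∖ (a∈ x) (b∈ x)

      b′∈ : Bits b′
      b′∈ x = subst Bit (cong (_-_ (b x)) (*-comm (b x) (a x))) (bit-∖ (b∈ x) (a∈ x))

  bits-exit : ∀ {a} → Bits a → ∀ d n x → a x ≡ 1ℤ → a (x ⊕ residue (+ n) ⊗ d) ≡ 0ℤ →
              ∃ λ y → a y ≡ 1ℤ × a (y ⊕ d) ≡ 0ℤ
  bits-exit {a} a∈ d zero x x∈ x+0∉ = contradiction (trans (sym x∈) (trans (cong a stay) x+0∉)) λ ()
    where
    stay : x ≡ x ⊕ residue 0ℤ ⊗ d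
    stay = solve 2 (λ x d → x := x :+ con 0ℤ :* d) refl x d
  bits-exit {a} a∈ d (suc n) x x∈ x+nd∉ with a∈ (x ⊕ d)
  ... | inj₁ x+d∉ = x , x∈ , x+d∉
  ... | inj₂ x+d∈ = bits-exit a∈ d n (x ⊕ d) x+d∈ (trans (cong a step) x+nd∉)
    where
    step : (x ⊕ d) ⊕ residue (+ n) ⊗ d ≡ x ⊕ residue (+ suc n) ⊗ d
    step = trans (solve 3 (λ x d r → (x :+ d) :+ r :* d := x :+ (con 1ℤ :+ r) :* d) refl x d (residue (+ n)))
      (cong (λ r → x ⊕ r ⊗ d) (sym (residue-+ 1ℤ (+ n))))

  -- Otherwise A would contain x + nd for all n, and these exhaust the field.
  bits-boundary : ∀ {a} → Bits a → 0ℤ < ∑ a → ∑ a < P → ∀ d → d ≢ 𝟎 →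
                  ∃ λ y → a y ≡ 1ℤ × a (y ⊕ d) ≡ 0ℤ
  bits-boundary {a} a∈ 0<a a<P d d≢0 =
    let x , x∈ = bits-member a∈ 0<a
        y , y∉ = bits-nonmember a∈ a<P
        e , de≡1 = inverse d d≢0
        multiple : x ⊕ residue (+ toℕ ((y ⊖ x) ⊗ e)) ⊗ d ≡ y
        multiple = trans (cong (λ r → x ⊕ r ⊗ d) (residue-toℕ ((y ⊖ x) ⊗ e)))
          (trans (solve 4 (λ x y d e → x :+ (y :- x) :* e :* d := x :+ (y :- x) :* (d :* e)) refl x y d e)
          (trans (cong (λ r → x ⊕ (y ⊖ x) ⊗ r) (trans de≡1 (sym residue-1)))
                 (solve 2 (λ x y → x :+ (y :- x) :* con 1ℤ := y) refl x y)))
    in bits-exit a∈ d (toℕ ((y ⊖ x) ⊗ e)) x x∈ (trans (cong a multiple) y∉)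

  private
    -- Pollard's inequality at level τ.
    Bound : (a b : Fin p → ℤ) → ℤ → Set
    Bound a b τ = τ * (∑ a + ∑ b - τ) ≤ ∑ λ z → conv a b z ⊓ τ

    -- At τ = |B| the truncation is vacuous, since 1_A ∗ 1_B never exceeds |B|, and both sides equal
    -- |A||B|.
    full-bound : ∀ {a b} → Bits a → Bits b → Bound a b (∑ b)
    full-bound {a} {b} a∈ b∈ = ≤-reflexive (trans (aux (∑ a) (∑ b))
      (trans (sym (∑-conv a b)) (∑-cong λ z → sym (i≤j⇒i⊓j≡i (conv-≤ a∈ b∈ z)))))
      where
      aux : ∀ a b → b * (a + b - b) ≡ a * b
      aux = solve-∀

    ⊓-superadditive : ∀ x y s t → x ⊓ s + y ⊓ t ≤ (x + y) ⊓ (s + t)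
    ⊓-superadditive x y s t = ⊓-glb (+-mono-≤ (i⊓j≤i x s) (i⊓j≤i y t)) (+-mono-≤ (i⊓j≤j x s) (i⊓j≤j y t))

    PollardUpTo : ℕ → Set
    PollardUpTo N = ∀ a b τ → Bits a → Bits b → ∑ b ≤ + N → 1ℤ ≤ τ → τ ≤ ∑ a → τ ≤ ∑ b →
                    ∑ a + ∑ b ≤ P + τ → Bound a b τ

    -- If τ ≤ |A ∩ B|, the pair (A ∪ B, A ∩ B) alone suffices. Otherwise τ is split: this pair is
    -- used at its full level |A ∩ B|, and the two differences at the remaining level τ - |A ∩ B|.
    -- The last two hypotheses make the second set of the pair in the induction smaller than B in
    -- either case.
    dyson-bound : ∀ N → PollardUpTo N → ∀ a b τ → Bits a → Bits b → ∑ b ≤ + suc N →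
                  1ℤ ≤ τ → τ ≤ ∑ a → τ ≤ ∑ b → ∑ a + ∑ b ≤ P + τ →
                  1ℤ ≤ ∑ (Dyson.i a b) → 1ℤ ≤ ∑ (Dyson.b′ a b) → Bound a b τ
    dyson-bound N IH a b τ a∈ b∈ b≤1+N 1≤τ τ≤a τ≤b ab≤ 1≤i 1≤b′ with τ ≤? ∑ (Dyson.i a b)
    ... | yes τ≤i = ≤-trans (≤-reflexive (cong (λ s → τ * (s - τ)) (sym u+i)))
        (≤-trans (IH u i τ (u∈ a∈ b∈) (i∈ a∈ b∈) i≤N 1≤τ τ≤u τ≤i (≤-trans (≤-reflexive u+i) ab≤))
        (∑-mono λ z → ⊓-mono-≤ (conv-mono z) ≤-refl))
      where
      open Dyson a b
      u+i : ∑ u + ∑ i ≡ ∑ a + ∑ b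
      u+i = trans (cong (_+ ∑ i) ∑u) (aux (∑ a) (∑ b) (∑ i))
        where
        aux : ∀ a b i → a + b - i + i ≡ a + b
        aux = solve-∀
      i≤N : ∑ i ≤ + N
      i≤N = aux (∑ b) (∑ i) (+ N) (subst (1ℤ ≤_) ∑b′ 1≤b′) b≤1+N
        where
        aux : ∀ b i N → 1ℤ ≤ b - i → b ≤ 1ℤ + N → i ≤ N
        aux b i N g h = by-difference (0≤+ (difference g) (difference h)) (ring (b ∷ i ∷ N ∷ []))
      τ≤u : τ ≤ ∑ u
      τ≤u = subst (τ ≤_) (sym ∑u) (aux (∑ a) (∑ b) (∑ i) τ τ≤a (subst (1ℤ ≤_) ∑b′ 1≤b′))
        where
        aux : ∀ a b i τ → τ ≤ a → 1ℤ ≤ b - i → τ ≤ a + b - i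
        aux a b i τ g h = by-difference (0≤+ (0≤+ (difference g) (difference h)) (bit-≥0 (inj₂ refl)))
          (((∀ a b i τ → a + b - i - τ ≡ a - τ + (b - i - 1ℤ) + 1ℤ) ∋ solve-∀) a b i τ)
      conv-mono : ∀ z → conv u i z ≤ conv a b z
      conv-mono z = subst₂ _≤_ (+-identityʳ (conv u i z)) (sym (conv-split z))
        (+-monoʳ-≤ (conv u i z) (conv-≥0 (a′∈ a∈ b∈) (b′∈ a∈ b∈) z))
    ... | no τ≰i = ≤-trans (≤-reflexive (sym count)) (≤-trans (+-mono-≤ first second)
        (≤-trans (≤-reflexive (sym (∑-+ {p} _ _))) (∑-mono pointwise)))
      where
      open Dyson a b
      A B I : ℤ
      A = ∑ a
      B = ∑ b
      I = ∑ i
      i<τ : 1ℤ + I ≤ τ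
      i<τ = i<j⇒suc[i]≤j (≰⇒> τ≰i)
      count : I * (∑ u + I - I) + (τ - I) * (∑ a′ + ∑ b′ - (τ - I)) ≡ τ * (A + B - τ)
      count = trans (cong₂ (λ s t → I * (s + I - I) + (τ - I) * (t - (τ - I))) ∑u (cong₂ _+_ ∑a′ ∑b′)) (aux A B I τ)
        where
        aux : ∀ A B I τ → I * (A + B - I + I - I) + (τ - I) * (A - I + (B - I) - (τ - I)) ≡ τ * (A + B - τ)
        aux = solve-∀
      first : Bound u i I
      first = full-bound (u∈ a∈ b∈) (i∈ a∈ b∈)
      second : Bound a′ b′ (τ - I)
      second = IH a′ b′ (τ - I) (a′∈ a∈ b∈) (b′∈ a∈ b∈)
        (subst (_≤ + N) (sym ∑b′) (aux₁ B I (+ N) b≤1+N 1≤i))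
        (aux₂ I τ i<τ)
        (subst (τ - I ≤_) (sym ∑a′) (+-monoˡ-≤ (- I) τ≤a))
        (subst (τ - I ≤_) (sym ∑b′) (+-monoˡ-≤ (- I) τ≤b))
        (subst (_≤ P + (τ - I)) (sym (cong₂ _+_ ∑a′ ∑b′)) (aux₃ A B I τ P ab≤ (≤-trans (bit-≥0 (inj₂ refl)) 1≤i)))
        where
        aux₁ : ∀ b i N → b ≤ 1ℤ + N → 1ℤ ≤ i → b - i ≤ N
        aux₁ b i N g h = by-difference (0≤+ (difference g) (difference h)) (ring (b ∷ i ∷ N ∷ []))
        aux₂ : ∀ i τ → 1ℤ + i ≤ τ → 1ℤ ≤ τ - i
        aux₂ i τ h = by-difference (difference h) (ring (i ∷ τ ∷ []))
        aux₃ : ∀ A B I τ P → A + B ≤ P + τ → 0ℤ ≤ I → A - I + (B - I) ≤ P + (τ - I)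
        aux₃ A B I τ P g h = by-difference (0≤+ (difference g) h) (ring (A ∷ B ∷ I ∷ τ ∷ P ∷ []))
      pointwise : ∀ z → conv u i z ⊓ I + conv a′ b′ z ⊓ (τ - I) ≤ conv a b z ⊓ τ
      pointwise z = subst (conv u i z ⊓ I + conv a′ b′ z ⊓ (τ - I) ≤_)
        (cong₂ _⊓_ (sym (conv-split z)) (aux I τ)) (⊓-superadditive (conv u i z) (conv a′ b′ z) I (τ - I))
        where
        aux : ∀ I τ → I + (τ - I) ≡ τ
        aux = solve-∀

  -- Induction on |B|: unless τ = |B|, some translate of B meets A without being contained in it.
  pollard : ∀ N a b τ → Bits a → Bits b → ∑ b ≤ + N → 1ℤ ≤ τ → τ ≤ ∑ a → τ ≤ ∑ b →
            ∑ a + ∑ b ≤ P + τ → τ * (∑ a + ∑ b - τ) ≤ ∑ λ z → conv a b z ⊓ τ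
  pollard zero a b τ a∈ b∈ b≤N 1≤τ τ≤a τ≤b ab≤ =
    contradiction (≤-trans 1≤τ (≤-trans τ≤b b≤N)) λ where (+≤+ ())
  pollard (suc N) a b τ a∈ b∈ b≤N 1≤τ τ≤a τ≤b ab≤ with τ ≟ ∑ b
  ... | yes refl = full-bound a∈ b∈
  ... | no τ≢b = untranslate (dyson-bound N (pollard N) a b̃ τ a∈ (b∈ ∘ (_⊖ c))
      (subst (_≤ + suc N) (sym ∑b̃) b≤N) 1≤τ τ≤a (subst (τ ≤_) (sym ∑b̃) τ≤b)
      (subst (λ B → ∑ a + B ≤ P + τ) (sym ∑b̃) ab≤)
      (subst (_≤ ∑ (Dyson.i a b̃)) y-in (∑-≥-term (bit-≥0 ∘ Dyson.i∈ a b̃ a∈ (b∈ ∘ (_⊖ c))) y))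
      (subst (_≤ ∑ (Dyson.b′ a b̃)) y+d-in (∑-≥-term (bit-≥0 ∘ Dyson.b′∈ a b̃ a∈ (b∈ ∘ (_⊖ c))) (y ⊕ d))))
    where
    τ<b : τ < ∑ b
    τ<b = ≤∧≢⇒< τ≤b τ≢b

    -- As |B| > τ, the size hypothesis makes A a proper subset of the field, so A has a boundary in
    -- every nonzero direction.
    a<P : ∑ a < P
    a<P = ≤-<-trans (aux (∑ a) (∑ b) P τ ab≤) (subst (P + τ - ∑ b <_) (id₁ P τ) (+-monoʳ-< (P + τ) (neg-mono-< τ<b)))
      where
      id₁ : ∀ P τ → P + τ - τ ≡ P
      id₁ = solve-∀
      aux : ∀ a b P τ → a + b ≤ P + τ → a ≤ P + τ - b
      aux a b P τ h = by-difference (difference h) (ring (a ∷ b ∷ P ∷ τ ∷ []))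

    0<a : 0ℤ < ∑ a
    0<a = <-≤-trans (+<+ (ℕ.s≤s ℕ.z≤n)) (≤-trans 1≤τ τ≤a)

    0<b : 0ℤ < ∑ b
    0<b = <-trans (<-≤-trans (+<+ (ℕ.s≤s ℕ.z≤n)) 1≤τ) τ<b

    β₀ β₁ d y c : Fin p
    β₀ = proj₁ (bits-member b∈ 0<b)
    β₁ = proj₁ (bits-another b∈ (≤-<-trans 1≤τ τ<b) β₀)
    d = β₁ ⊖ β₀

    d≢0 : d ≢ 𝟎
    d≢0 e = proj₂ (proj₂ (bits-another b∈ (≤-<-trans 1≤τ τ<b) β₀))
      (trans (solve 2 (λ x y → x := x :- y :+ y) refl β₁ β₀)
      (trans (cong (_⊕ β₀) (trans e (sym residue-0))) (solve 1 (λ y → con 0ℤ :+ y := y) refl β₀)))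

    boundary : ∃ λ y → a y ≡ 1ℤ × a (y ⊕ d) ≡ 0ℤ
    boundary = bits-boundary a∈ 0<a a<P d d≢0

    y = proj₁ boundary
    -- Translation by c carries β₀ to y, inside A, and β₁ to y + d, outside A; so the translate of B
    -- meets A without being contained in it.
    c = y ⊖ β₀

    b̃ : Fin p → ℤ
    b̃ x = b (x ⊖ c)

    ∑b̃ : ∑ b̃ ≡ ∑ b
    ∑b̃ = ∑-shift (⊝ c) b

    b̃-y : b̃ y ≡ 1ℤ
    b̃-y = trans (cong b (solve 2 (λ y β → y :- (y :- β) := β) refl y β₀)) (proj₂ (bits-member b∈ 0<b))

    b̃-y+d : b̃ (y ⊕ d) ≡ 1ℤ
    b̃-y+d = trans (cong b (solve 3 (λ y β₀ β₁ → y :+ (β₁ :- β₀) :- (y :- β₀) := β₁) refl y β₀ β₁))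
      (proj₁ (proj₂ (bits-another b∈ (≤-<-trans 1≤τ τ<b) β₀)))

    y-in : Dyson.i a b̃ y ≡ 1ℤ
    y-in = cong₂ _*_ (proj₁ (proj₂ boundary)) b̃-y

    y+d-in : Dyson.b′ a b̃ (y ⊕ d) ≡ 1ℤ
    y+d-in = cong₂ (λ s t → t - s * t) (proj₂ (proj₂ boundary)) b̃-y+d

    untranslate : Bound a b̃ τ → Bound a b τ
    untranslate = subst₂ _≤_ (cong (λ B → τ * (∑ a + B - τ)) ∑b̃)
      (trans (∑-cong λ z → cong (_⊓ τ) (conv-shift a b c z)) (∑-shift (⊝ c) (λ z → conv a b z ⊓ τ)))

  -- Pollard's theorem bounds the sum of min(1_A ∗ 1_A, τ) over all z. The z outside A account for
  -- at most τ each, which leaves τ(3|A| - P - τ) ≥ τ². When 2|A| ≥ P + τ, every z has at least 2|A|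
  -- - P ≥ τ representations by inclusion-exclusion.
  schur-count : ∀ a τ → Bits a → 1ℤ ≤ τ → τ ≤ P → P + (τ + τ) ≤ + 3 * ∑ a →
                τ * τ ≤ ∑ λ z → a z * conv a a z
  schur-count a τ a∈ 1≤τ τ≤P P+2τ≤3a with ≤-total (∑ a + ∑ a) (P + τ)
  ... | inj₁ 2a≤P+τ = ≤-trans (aux (∑ a) P τ 0≤τ P+2τ≤3a)
      (≤-trans (+-monoˡ-≤ (- (τ * (P - ∑ a)))
        (pollard p a a τ a∈ a∈ (∑-bits-≤ a∈) 1≤τ τ≤a τ≤a 2a≤P+τ))
      (subst (_≤ ∑ λ z → a z * conv a a z) drop (∑-mono pointwise)))
    where
    0≤τ : 0ℤ ≤ τ
    0≤τ = ≤-trans (bit-≥0 (inj₂ refl)) 1≤τ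
    τ≤a : τ ≤ ∑ a
    τ≤a = cancelˡ-≤ {+ 3} (+<+ (ℕ.s≤s ℕ.z≤n)) (aux₁ (∑ a) P τ τ≤P P+2τ≤3a)
      where
      aux₁ : ∀ a P τ → τ ≤ P → P + (τ + τ) ≤ + 3 * a → + 3 * τ ≤ + 3 * a
      aux₁ a P τ g h = by-difference (0≤+ (difference g) (difference h)) (ring (a ∷ P ∷ τ ∷ []))
    aux : ∀ a P τ → 0ℤ ≤ τ → P + (τ + τ) ≤ + 3 * a → τ * τ ≤ τ * (a + a - τ) - τ * (P - a)
    aux a P τ h g = by-difference (0≤* h (difference g)) (ring (a ∷ P ∷ τ ∷ []))
    drop : ∑ (λ z → conv a a z ⊓ τ - τ * (1ℤ - a z)) ≡ ∑ (λ z → conv a a z ⊓ τ) - τ * (P - ∑ a)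
    drop = trans (∑-- {p} _ _) (cong (_-_ (∑ λ z → conv a a z ⊓ τ))
      (trans (∑-*ˡ τ (λ z → 1ℤ - a z)) (cong (τ *_) (trans (∑-- {p} _ a) (cong (_- ∑ a) (∑-1 {p}))))))
    pointwise : ∀ z → conv a a z ⊓ τ - τ * (1ℤ - a z) ≤ a z * conv a a z
    pointwise z with a z | a∈ z
    ... | _ | inj₁ refl = by-difference (difference (i⊓j≤j (conv a a z) τ)) (id₀ (conv a a z ⊓ τ) τ (conv a a z))
      where
      id₀ : ∀ m τ c → 0ℤ * c - (m - τ * (1ℤ - 0ℤ)) ≡ τ - m
      id₀ = solve-∀
    ... | _ | inj₂ refl = by-difference (difference (i⊓j≤i (conv a a z) τ)) (id₁ (conv a a z ⊓ τ) τ (conv a a z))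
      where
      id₁ : ∀ m τ c → 1ℤ * c - (m - τ * (1ℤ - 1ℤ)) ≡ c - m
      id₁ = solve-∀
  ... | inj₂ P+τ≤2a = ≤-trans (*-monoˡ (≤-trans (bit-≥0 (inj₂ refl)) 1≤τ) τ≤a)
      (subst (_≤ ∑ λ z → a z * conv a a z) (trans (∑-*ʳ τ a) (*-comm (∑ a) τ))
        (∑-mono λ z → *-monoˡ (bit-≥0 (a∈ z)) (τ≤conv z)))
    where
    τ≤a : τ ≤ ∑ a
    τ≤a = aux (∑ a) P τ (∑-bits-≤ a∈) P+τ≤2a
      where
      aux : ∀ a P τ → a ≤ P → P + τ ≤ a + a → τ ≤ a
      aux a P τ g h = by-difference (0≤+ (difference g) (difference h)) (ring (a ∷ P ∷ τ ∷ []))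
    inclusion-exclusion : ∀ {s t} → Bit s → Bit t → s + t - 1ℤ ≤ s * t
    inclusion-exclusion (inj₁ refl) (inj₁ refl) = -≤+
    inclusion-exclusion (inj₁ refl) (inj₂ refl) = ≤-refl
    inclusion-exclusion (inj₂ refl) (inj₁ refl) = ≤-refl
    inclusion-exclusion (inj₂ refl) (inj₂ refl) = ≤-refl
    τ≤conv : ∀ z → τ ≤ conv a a z
    τ≤conv z = ≤-trans (aux (∑ a) P τ P+τ≤2a)
      (subst (_≤ conv a a z) count (∑-mono λ x → inclusion-exclusion (a∈ x) (a∈ (z ⊖ x))))
      where
      aux : ∀ a P τ → P + τ ≤ a + a → τ ≤ a + a - P
      aux a P τ h = by-difference (difference h) (ring (a ∷ P ∷ τ ∷ []))
      count : ∑ (λ x → a x + a (z ⊖ x) - 1ℤ) ≡ ∑ a + ∑ a - P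
      count = trans (∑-- {p} _ _) (cong₂ _-_ (trans (∑-+ a _) (cong (_+_ (∑ a)) (∑-reflect z a))) (∑-1 {p}))

-- Second-moment equidistribution of a multiplicative subgroup.

module Equidistribution {p} (F : PrimeFields.PrimeField p) where

  open PrimeFields.PrimeField F
  open IntegerSums
  open Pollard F using (∑-shift)
  open import Data.Fin.Base using (Fin)
  open import Data.Fin.Properties using () renaming (_≟_ to _≟ᶠ_)
  open import Data.Integer hiding (suc; _⊖_)
  open import Data.Integer.Properties
  open import Data.Integer.Tactic.RingSolver using (solve-∀)
  open import Data.Product.Base using (_×_; _,_; proj₁; proj₂)
  open import Data.Sum.Base using (inj₁; inj₂)
  open import Function.Base using (_∘_)
  open import Relation.Binary.PropositionalEquality

  private
    P : ℤ
    P = + p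

    ∑-affine : ∀ u d f → u ≢ 𝟎 → ∑ (λ l → f (l ⊗ u ⊕ d)) ≡ ∑ f
    ∑-affine u d f u≢0 with inverse u u≢0
    ... | v , uv≡1 = ∑-bijection (λ l → l ⊗ u ⊕ d) (λ y → (y ⊖ d) ⊗ v)
      (λ y → trans (solve 4 (λ y d u v → (y :- d) :* v :* u :+ d := (y :- d) :* (u :* v) :+ d) refl y d u v)
        (trans (cong (λ r → (y ⊖ d) ⊗ r ⊕ d) uv≡𝟏)
          (solve 2 (λ y d → (y :- d) :* con 1ℤ :+ d := y) refl y d)))
      (λ l → trans (solve 4 (λ l d u v → (l :* u :+ d :- d) :* v := l :* (u :* v)) refl l d u v)
        (trans (cong (l ⊗_) uv≡𝟏) (solve 1 (λ l → l :* con 1ℤ := l) refl l)))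
      f
      where
      uv≡𝟏 : u ⊗ v ≡ residue 1ℤ
      uv≡𝟏 = trans uv≡1 (sym residue-1)

  module _ (f w : Fin p → ℤ) (∑f≡0 : ∑ f ≡ 0ℤ) where

    private
      corr : Fin p → Fin p → ℤ
      corr h k = ∑ λ l → ∑ λ d → f (l ⊗ h ⊕ d) * f (l ⊗ k ⊕ d)

      corr-diagonal : ∀ h → corr h h ≡ P * ∑ (sq ∘ f)
      corr-diagonal h = trans (∑-cong λ l → trans
          (∑-cong λ d → cong (sq ∘ f) (solve 2 (λ a d → a :+ d := d :+ a) refl (l ⊗ h) d))
          (∑-shift (l ⊗ h) (sq ∘ f)))
        (∑-const {p} _)

      -- As l varies, l (k − h) + d is equidistributed, and f has mean zero.
      corr-off-diagonal : ∀ h k → k ≢ h → corr h k ≡ 0ℤ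
      corr-off-diagonal h k k≢h = trans (∑-cong recentre)
        (trans (∑-comm (λ l d → f d * f (l ⊗ u ⊕ d)))
        (∑-0 λ d → trans (∑-*ˡ (f d) (λ l → f (l ⊗ u ⊕ d)))
          (trans (cong (f d *_) (trans (∑-affine u d f u≢0) ∑f≡0)) (*-zeroʳ (f d)))))
        where
        u : Fin p
        u = k ⊖ h
        u≢0 : u ≢ 𝟎
        u≢0 e = k≢h (trans (solve 2 (λ k h → k := k :- h :+ h) refl k h)
          (trans (cong (_⊕ h) (trans e (sym residue-0))) (solve 1 (λ h → con 0ℤ :+ h := h) refl h)))
        recentre : ∀ l → (∑ λ d → f (l ⊗ h ⊕ d) * f (l ⊗ k ⊕ d)) ≡ ∑ λ d → f d * f (l ⊗ u ⊕ d)
        recentre l = trans (∑-cong λ d → cong₂ (λ x y → f x * f y)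
            (solve 3 (λ l h d → l :* h :+ d := d :+ l :* h) refl l h d)
            (solve 4 (λ l k h d → l :* k :+ d := l :* (k :- h) :+ (d :+ l :* h)) refl l k h d))
          (∑-shift (l ⊗ h) (λ d → f d * f (l ⊗ u ⊕ d)))

    spread : Fin p → Fin p → ℤ
    spread l d = ∑ λ h → w h * f (l ⊗ h ⊕ d)

    -- Expanding the square and exchanging sums gives the sum of w(h) w(k) `corr h k`, of which only
    -- the diagonal survives.
    ∑-spread² : (∑ λ l → ∑ λ d → sq (spread l d)) ≡ P * ∑ (sq ∘ f) * ∑ (sq ∘ w)
    ∑-spread² = trans (∑-cong λ l → ∑-cong λ d → ∑-* (term l d) (term l d))
      (trans (∑-cong λ l → ∑-comm (λ d h → ∑ λ k → term l d h * term l d k))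
      (trans (∑-comm (λ l h → ∑ λ d → ∑ λ k → term l d h * term l d k))
      (trans (∑-cong λ h → trans
          (∑-cong λ l → ∑-comm (λ d k → term l d h * term l d k))
          (∑-comm (λ l k → ∑ λ d → term l d h * term l d k)))
      (trans (∑-cong λ h → trans (∑-cong (factor h)) (trans
          (∑-single h λ k k≢h → trans (cong (w h * w k *_) (corr-off-diagonal h k k≢h)) (*-zeroʳ (w h * w k)))
          (trans (cong (w h * w h *_) (corr-diagonal h)) (*-comm (w h * w h) _))))
      (∑-*ˡ (P * ∑ (sq ∘ f)) (sq ∘ w))))))
      where
      term : Fin p → Fin p → Fin p → ℤ
      term l d h = w h * f (l ⊗ h ⊕ d)
      factor : ∀ h k → (∑ λ l → ∑ λ d → term l d h * term l d k) ≡ w h * w k * corr h k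
      factor h k = trans (∑-cong λ l → trans
          (∑-cong λ d → interchange (w h) (f (l ⊗ h ⊕ d)) (w k) (f (l ⊗ k ⊕ d)))
          (∑-*ˡ (w h * w k) (λ d → f (l ⊗ h ⊕ d) * f (l ⊗ k ⊕ d))))
        (∑-*ˡ (w h * w k) (λ l → ∑ λ d → f (l ⊗ h ⊕ d) * f (l ⊗ k ⊕ d)))
        where
        interchange : ∀ a b c d → a * b * (c * d) ≡ a * c * (b * d)
        interchange = solve-∀

    -- Substituting d l for d makes the argument l (h + d), and invariance of f removes the factor
    -- l.
    ∑-spread-invariant : ∀ l → l ≢ 𝟎 → (∀ x → f (l ⊗ x) ≡ f x) →
                         ∑ (sq ∘ spread l) ≡ ∑ λ d → sq (∑ λ h → w h * f (h ⊕ d))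
    ∑-spread-invariant l l≢0 f-inv = trans (sym (∑-affine l 𝟎 (sq ∘ spread l) l≢0))
      (∑-cong λ d → cong sq (∑-cong λ h → cong (w h *_) (trans (cong f (regroup h d)) (f-inv (h ⊕ d)))))
      where
      regroup : ∀ h d → l ⊗ h ⊕ (d ⊗ l ⊕ 𝟎) ≡ l ⊗ (h ⊕ d)
      regroup h d = trans (cong (λ z → l ⊗ h ⊕ (d ⊗ l ⊕ z)) (sym residue-0))
        (solve 3 (λ l h d → l :* h :+ (d :* l :+ con 0ℤ) := l :* (h :+ d)) refl l h d)

  -- Every dilate of the translates of w by an element of Γ has the same variance; summing
  -- over all dilates costs only the diagonal.
  variance-bound : ∀ γ w → Bits γ → Bits w → 0ℤ < ∑ γ →
    (∀ l → γ l ≡ 1ℤ → l ≢ 𝟎 × (∀ x → γ (l ⊗ x) ≡ γ x)) →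
    (∑ λ d → sq (P * (∑ λ h → w h * γ (h ⊕ d)) - ∑ γ * ∑ w)) ≤ P * P * P * ∑ w
  variance-bound γ w γ∈ w∈ 0<n γ-inv = cancelˡ-≤ 0<n (≤-trans (≤-reflexive (sym (∑-*ʳ V γ)))
    (≤-trans (∑-mono one-dilate) (≤-trans (≤-reflexive (∑-spread² f w ∑f≡0)) final)))
    where
    n : ℤ
    n = ∑ γ
    -- The balanced function of Γ, scaled by P to stay integral.
    f : Fin p → ℤ
    f x = P * γ x - n
    ∑f≡0 : ∑ f ≡ 0ℤ
    ∑f≡0 = trans (∑-- {p} _ _) (trans (cong₂ _-_ (∑-*ˡ P γ) (∑-const {p} n)) (+-inverseʳ (P * n)))
    V : ℤ
    V = ∑ λ d → sq (P * (∑ λ h → w h * γ (h ⊕ d)) - n * ∑ w)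
    expand : ∀ d → (∑ λ h → w h * f (h ⊕ d)) ≡ P * (∑ λ h → w h * γ (h ⊕ d)) - n * ∑ w
    expand d = trans (∑-cong λ h → aux (w h) P (γ (h ⊕ d)) n)
      (trans (∑-- {p} _ _) (cong₂ _-_ (∑-*ˡ P (λ h → w h * γ (h ⊕ d))) (∑-*ˡ n w)))
      where
      aux : ∀ w P g n → w * (P * g - n) ≡ P * (w * g) - n * w
      aux = solve-∀
    one-dilate : ∀ l → γ l * V ≤ ∑ λ d → sq (spread f w ∑f≡0 l d)
    one-dilate l with γ l in γl | γ∈ l
    ... | _ | inj₁ refl = subst (_≤ ∑ λ d → sq (spread f w ∑f≡0 l d)) (sym (*-zeroˡ V))
      (∑-nonneg λ d → 0≤sq (spread f w ∑f≡0 l d))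
    ... | _ | inj₂ refl = ≤-reflexive (trans (*-identityˡ V) (sym
      (trans (∑-spread-invariant f w ∑f≡0 l (proj₁ (γ-inv l γl)) λ x → cong (λ g → P * g - n) (proj₂ (γ-inv l γl) x))
      (∑-cong (cong sq ∘ expand)))))
    ∑f² : ∑ (sq ∘ f) ≡ P * P * n - P * (n * n)
    ∑f² = trans (∑-cong λ x → trans (aux₁ P (γ x) n) (cong (λ g → P * P * g - (P * n * (γ x + γ x) - n * n)) (bit-idem (γ∈ x))))
      (trans (∑-- {p} _ _) (trans (cong₂ _-_ (∑-*ˡ (P * P) γ)
        (trans (∑-- {p} _ _) (cong₂ _-_ (trans (∑-*ˡ (P * n) (λ x → γ x + γ x)) (cong (P * n *_) (∑-+ γ γ))) (∑-const {p} (n * n)))))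
      (aux₂ P n)))
      where
      aux₁ : ∀ P g n → (P * g - n) * (P * g - n) ≡ P * P * (g * g) - (P * n * (g + g) - n * n)
      aux₁ = solve-∀
      aux₂ : ∀ P n → P * P * n - (P * n * (n + n) - P * (n * n)) ≡ P * P * n - P * (n * n)
      aux₂ = solve-∀
    final : P * ∑ (sq ∘ f) * ∑ (sq ∘ w) ≤ n * (P * P * P * ∑ w)
    final = subst₂ (λ s t → P * s * t ≤ n * (P * P * P * ∑ w)) (sym ∑f²) (sym (∑-cong (bit-idem ∘ w∈)))
      (by-difference (0≤* (0≤sq (P * n)) (∑-nonneg (bit-≥0 ∘ w∈))) (aux P n (∑ w)))
      where
      aux : ∀ P n W → n * (P * P * P * W) - P * (P * P * n - P * (n * n)) * W ≡ P * n * (P * n) * W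
      aux = solve-∀

-- Croot-Sisask almost periodicity by sampling.

module AlmostPeriods {p} (F : PrimeFields.PrimeField p) where

  open PrimeFields.PrimeField F
  open IntegerSums
  open Pollard F using (∑-shift; conv; conv-≥0; ∑-conv)
  open import Data.Fin.Base using (Fin)
  open import Data.Integer hiding (suc; _⊖_)
  open import Data.Integer.Properties
  open import Data.Integer.Tactic.RingSolver using (solve-∀)
  open import Data.Nat.Base as ℕ using (ℕ; suc; zero)
  open import Data.Product.Base using (∃; ∃₂; _×_; _,_; proj₁; proj₂)
  open import Data.Sum.Base using (inj₂)
  open import Data.Vec.Base using (Vec; _∷_; []; map)
  open import Function.Base using (_∘_; _∋_)
  open import Relation.Binary.PropositionalEquality

  private
    P : ℤ
    P = + p

    Tuple : ℕ → Set
    Tuple = Vec (Fin p)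

  ∑∑ : ∀ k → (Tuple k → ℤ) → ℤ
  ∑∑ zero    φ = φ []
  ∑∑ (suc k) φ = ∑ λ b → ∑∑ k λ bs → φ (b ∷ bs)

  ∑∑-cong : ∀ k {φ ψ} → (∀ b → φ b ≡ ψ b) → ∑∑ k φ ≡ ∑∑ k ψ
  ∑∑-cong zero    e = e []
  ∑∑-cong (suc k) e = ∑-cong λ b → ∑∑-cong k λ bs → e (b ∷ bs)

  ∑∑-+ : ∀ k φ ψ → ∑∑ k (λ b → φ b + ψ b) ≡ ∑∑ k φ + ∑∑ k ψ
  ∑∑-+ zero    φ ψ = refl
  ∑∑-+ (suc k) φ ψ = trans (∑-cong λ b → ∑∑-+ k (φ ∘ (b ∷_)) (ψ ∘ (b ∷_))) (∑-+ {p} _ _)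

  ∑∑-*ˡ : ∀ k c φ → ∑∑ k (λ b → c * φ b) ≡ c * ∑∑ k φ
  ∑∑-*ˡ zero    c φ = refl
  ∑∑-*ˡ (suc k) c φ = trans (∑-cong λ b → ∑∑-*ˡ k c (φ ∘ (b ∷_))) (∑-*ˡ {p} c _)

  ∑∑-∑-comm : ∀ k (t : Tuple k → Fin p → ℤ) → ∑∑ k (λ b → ∑ (t b)) ≡ ∑ λ x → ∑∑ k λ b → t b x
  ∑∑-∑-comm zero    t = refl
  ∑∑-∑-comm (suc k) t = trans (∑-cong λ b → ∑∑-∑-comm k (t ∘ (b ∷_)))
    (∑-comm (λ b x → ∑∑ k λ bs → t (b ∷ bs) x))

  translate : ∀ {k} → Tuple k → Fin p → Tuple k
  translate b h = map (_⊕ h) b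

  translate-⊕ : ∀ {k} (b : Tuple k) g h → translate (translate b g) h ≡ translate b (h ⊕ g)
  translate-⊕ []       g h = refl
  translate-⊕ (b ∷ bs) g h =
    cong₂ _∷_ (solve 3 (λ b g h → b :+ g :+ h := b :+ (h :+ g)) refl b g h) (translate-⊕ bs g h)

  ∑∑-translate : ∀ k φ h → ∑∑ k (λ b → φ (translate b h)) ≡ ∑∑ k φ
  ∑∑-translate zero    φ h = refl
  ∑∑-translate (suc k) φ h = trans (∑-cong λ b → ∑∑-translate k (φ ∘ ((b ⊕ h) ∷_)) h)
    (∑-shift h (λ b → ∑∑ k (φ ∘ (b ∷_))))

  ∑∑-≤-max : ∀ k φ → ∃ λ b → ∑∑ k φ ≤ P ^ k * φ b
  ∑∑-≤-max zero    φ = [] , ≤-reflexive (sym (*-identityˡ (φ [])))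
  ∑∑-≤-max (suc k) φ =
    let b  , ≤b  = ∑-≤-max 𝟎 (λ b → ∑∑ k (φ ∘ (b ∷_)))
        bs , ≤bs = ∑∑-≤-max k (φ ∘ (b ∷_))
    in b ∷ bs , ≤-trans ≤b (subst (P * ∑∑ k (φ ∘ (b ∷_)) ≤_) (sym (*-assoc P (P ^ k) (φ (b ∷ bs))))
                                  (*-monoˡ {P} (+≤+ ℕ.z≤n) ≤bs))

  module _ (s : Fin p → ℤ) (s∈ : Bits s) where

    private
      σ : ℤ
      σ = ∑ s

      S : Fin p → ℤ
      S = conv s s

      0≤σ : 0ℤ ≤ σ
      0≤σ = ∑-nonneg (bit-≥0 ∘ s∈)

      weight : ∀ {k} → Tuple k → ℤ
      weight []       = 1ℤ
      weight (b ∷ bs) = s b * weight bs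

      weight∈ : ∀ {k} (b : Tuple k) → Bit (weight b)
      weight∈ []       = inj₂ refl
      weight∈ (b ∷ bs) = bit-* (s∈ b) (weight∈ bs)

      -- For b uniform in Sᵏ the expectation of `sample b x` is k S(x); the factor σ clears the
      -- denominator.
      sample : ∀ {k} → Tuple k → Fin p → ℤ
      sample []       x = 0ℤ
      sample (b ∷ bs) x = σ * s (x ⊖ b) + sample bs x

      sample-translate : ∀ {k} (b : Tuple k) h x → sample (translate b h) (x ⊕ h) ≡ sample b x
      sample-translate []       h x = refl
      sample-translate (b ∷ bs) h x = cong₂ (λ y r → σ * s y + r)
        (solve 3 (λ x h b → x :+ h :- (b :+ h) := x :- b) refl x h b) (sample-translate bs h x)

      error : ∀ {k} → Fin p → Tuple k → ℤ
      error {k} x b = + k * S x - sample b x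

      error₁ : Fin p → Fin p → ℤ
      error₁ x b = S x - σ * s (x ⊖ b)

      error-∷ : ∀ {k} x b (bs : Tuple k) → error x (b ∷ bs) ≡ error₁ x b + error x bs
      error-∷ {k} x b bs = aux (+ k) (S x) (σ * s (x ⊖ b)) (sample bs x)
        where
        aux : ∀ k f t r → (1ℤ + k) * f - (t + r) ≡ f - t + (k * f - r)
        aux = solve-∀

      ∑-error₁ : ∀ x → ∑ (λ b → s b * error₁ x b) ≡ 0ℤ
      ∑-error₁ x = trans (∑-cong λ b → aux₁ (s b) (S x) σ (s (x ⊖ b)))
        (trans (∑-- {p} _ _) (trans (cong₂ _-_ (∑-*ʳ (S x) s) (∑-*ˡ σ (λ b → s b * s (x ⊖ b))))
        (+-inverseʳ (σ * S x))))
        where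
        aux₁ : ∀ a f σ c → a * (f - σ * c) ≡ a * f - σ * (a * c)
        aux₁ = solve-∀

      ∑-error₁² : ∀ x → ∑ (λ b → s b * sq (error₁ x b)) ≡ σ * (σ * S x - sq (S x))
      ∑-error₁² x = trans (∑-cong λ b → trans (aux₁ (s b) (S x) σ (s (x ⊖ b)))
          (cong (λ c → s b * sq (S x) + (- (+ 2 * S x * σ) * (s b * s (x ⊖ b)) + sq σ * (s b * c))) (bit-idem (s∈ (x ⊖ b)))))
        (trans (∑-+ {p} _ _) (trans (cong₂ _+_ (∑-*ʳ (sq (S x)) s) (trans (∑-+ {p} _ _)
          (cong₂ _+_ (∑-*ˡ (- (+ 2 * S x * σ)) (λ b → s b * s (x ⊖ b))) (∑-*ˡ (sq σ) (λ b → s b * s (x ⊖ b))))))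
        (aux₂ σ (S x))))
        where
        aux₁ : ∀ a f σ c → a * ((f - σ * c) * (f - σ * c)) ≡ a * (f * f) + (- (+ 2 * f * σ) * (a * c) + σ * σ * (a * (c * c)))
        aux₁ = solve-∀
        aux₂ : ∀ σ f → σ * (f * f) + (- (+ 2 * f * σ) * f + σ * σ * f) ≡ σ * (σ * f - f * f)
        aux₂ = solve-∀

      moment₀ : ∀ k → ∑∑ k weight ≡ σ ^ k
      moment₀ zero    = refl
      moment₀ (suc k) = trans (∑-cong λ b → trans (∑∑-*ˡ k (s b) weight) (cong (s b *_) (moment₀ k)))
        (∑-*ʳ (σ ^ k) s)

      moment₁ : ∀ k x → ∑∑ k (λ b → weight b * error x b) ≡ 0ℤ
      moment₁ zero    x = refl
      moment₁ (suc k) x = trans (∑-cong λ b → trans (∑∑-cong k λ bs →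
            trans (cong (s b * weight bs *_) (error-∷ x b bs)) (aux (s b) (weight bs) (error₁ x b) (error x bs)))
          (trans (∑∑-+ k _ _) (cong₂ _+_ (trans (∑∑-*ˡ k (s b * error₁ x b) weight) (cong (s b * error₁ x b *_) (moment₀ k)))
            (trans (∑∑-*ˡ k (s b) (λ bs → weight bs * error x bs)) (trans (cong (s b *_) (moment₁ k x)) (*-zeroʳ (s b)))))))
        (trans (∑-cong λ b → +-identityʳ (s b * error₁ x b * σ ^ k)) (trans (∑-*ʳ (σ ^ k) (λ b → s b * error₁ x b))
          (trans (cong (_* σ ^ k) (∑-error₁ x)) (*-zeroˡ (σ ^ k)))))
        where
        aux : ∀ a w y d → a * w * (y + d) ≡ a * y * w + a * (w * d)
        aux = solve-∀

      -- The variance of a sum of k independent errors, before division by σᵏ: the cross terms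
      -- vanish by `moment₁`, and each draw contributes σ S(x) - S(x)².
      moment₂ : ∀ k x → ∑∑ k (λ b → weight b * sq (error x b)) ≡ + k * σ ^ k * (σ * S x - sq (S x))
      moment₂ zero    x = sym (*-zeroˡ (σ * S x - sq (S x)))
      moment₂ (suc k) x = trans (∑-cong λ b → trans (∑∑-cong k λ bs →
            trans (cong (λ e → s b * weight bs * sq e) (error-∷ x b bs)) (aux₁ (s b) (weight bs) (error₁ x b) (error x bs)))
          (trans (∑∑-+ k _ _) (cong₂ _+_
            (trans (∑∑-*ˡ k (s b * sq (error₁ x b)) weight) (cong (s b * sq (error₁ x b) *_) (moment₀ k)))
            (trans (∑∑-+ k _ _) (cong₂ _+_
              (trans (∑∑-*ˡ k (+ 2 * s b * error₁ x b) (λ bs → weight bs * error x bs))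
                (trans (cong (+ 2 * s b * error₁ x b *_) (moment₁ k x)) (*-zeroʳ (+ 2 * s b * error₁ x b))))
              (trans (∑∑-*ˡ k (s b) (λ bs → weight bs * sq (error x bs))) (cong (s b *_) (moment₂ k x))))))))
        (trans (∑-+ {p} _ _) (trans (cong₂ _+_
            (trans (∑-*ʳ (σ ^ k) (λ b → s b * sq (error₁ x b))) (cong (_* σ ^ k) (∑-error₁² x)))
            (trans (∑-cong λ b → +-identityˡ (s b * (+ k * σ ^ k * (σ * S x - sq (S x))))) (∑-*ʳ (+ k * σ ^ k * (σ * S x - sq (S x))) s)))
          (aux₂ σ (σ * S x - sq (S x)) (σ ^ k) (+ k))))
        where
        aux₁ : ∀ a w y d → a * w * ((y + d) * (y + d)) ≡ a * (y * y) * w + (+ 2 * a * y * (w * d) + a * (w * (d * d)))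
        aux₁ = solve-∀
        aux₂ : ∀ σ v t k → σ * v * t + σ * (k * t * v) ≡ (1ℤ + k) * (σ * t) * v
        aux₂ = solve-∀

      total-error : ∀ {k} → Tuple k → ℤ
      total-error b = ∑ λ x → sq (error x b)

      mean-error : ∀ k → ∑∑ k (λ b → weight b * total-error b) ≤ + k * (σ * σ * σ) * σ ^ k
      mean-error k = subst₂ _≤_
        (sym (trans (∑∑-cong k λ b → sym (∑-*ˡ (weight b) (λ x → sq (error x b))))
                    (∑∑-∑-comm k (λ b x → weight b * sq (error x b)))))
        (trans (∑-*ˡ (+ k * σ ^ k * σ) S) (trans (cong (+ k * σ ^ k * σ *_) (∑-conv s s)) (aux₁ (+ k) (σ ^ k) σ)))
        (∑-mono λ x → subst (_≤ + k * σ ^ k * σ * S x) (sym (moment₂ k x))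
          (by-difference (0≤* (0≤* {+ k} (+≤+ ℕ.z≤n) (0≤^ k 0≤σ)) (0≤sq (S x))) (aux₂ (+ k) (σ ^ k) σ (S x))))
        where
        aux₁ : ∀ k t σ → k * t * σ * (σ * σ) ≡ k * (σ * σ * σ) * t
        aux₁ = solve-∀
        aux₂ : ∀ k t σ f → k * t * σ * f - k * t * (σ * f - f * f) ≡ k * t * (f * f)
        aux₂ = solve-∀

      -- The translation passes from the sample to S. So one function, `sample b`, serves every
      -- translate of S by an h for which b + h is a good sample.
      total-error-translate : ∀ {k} (b : Tuple k) h →
        total-error (translate b h) ≡ ∑ λ x → sq (+ k * S (x ⊕ h) - sample b x)
      total-error-translate {k} b h = trans (sym (∑-shift h (λ x → sq (error x (translate b h)))))
        (∑-cong λ x → cong (λ r → sq (+ k * S (x ⊕ h) - r)) (sample-translate b h x))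

    module _ (k : ℕ) where

      private
        -- Twice the mean error, so that `gain`, the reward for a tuple in Sᵏ with error below C, is
        -- positive on average.
        C : ℤ
        C = + 2 * + k * (σ * σ * σ)

        gain : Tuple k → ℤ
        gain b = weight b * (C - total-error b)

        gain-expand : ∀ b → gain b ≡ C * weight b + -1ℤ * (weight b * total-error b)
        gain-expand b = aux (weight b) C (total-error b)
          where
          aux : ∀ w C e → w * (C - e) ≡ C * w + -1ℤ * (w * e)
          aux = solve-∀

        ∑∑-gain : + k * (σ * σ * σ) * σ ^ k ≤ ∑∑ k gain
        ∑∑-gain = subst (+ k * (σ * σ * σ) * σ ^ k ≤_) (sym (trans (∑∑-cong k gain-expand)
            (trans (∑∑-+ k _ _) (cong₂ _+_ (trans (∑∑-*ˡ k C weight) (cong (C *_) (moment₀ k)))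
              (∑∑-*ˡ k -1ℤ (λ b → weight b * total-error b))))))
          (aux (+ k) (σ * σ * σ) (σ ^ k) _ (mean-error k))
          where
          aux : ∀ k c t m → m ≤ k * c * t → k * c * t ≤ + 2 * k * c * t + -1ℤ * m
          aux k c t m h = by-difference (difference h)
            (((∀ k c t m → + 2 * k * c * t + -1ℤ * m - k * c * t ≡ k * c * t - m) ∋ solve-∀) k c t m)

        orbit-gain : Tuple k → ℤ
        orbit-gain b = ∑ λ h → gain (translate b h)

        orbit-gain-translate : ∀ b g → orbit-gain (translate b g) ≡ orbit-gain b
        orbit-gain-translate b g = trans (∑-cong λ h → cong gain (translate-⊕ b g h))
          (∑-shift g (λ h → gain (translate b h)))

        good-orbit : ∃ λ b → P * (+ k * (σ * σ * σ) * σ ^ k) ≤ P ^ k * orbit-gain b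
        good-orbit with ∑∑-≤-max k orbit-gain
        ... | b , ≤b = b , ≤-trans (*-monoˡ {P} (+≤+ ℕ.z≤n) ∑∑-gain) (subst (_≤ P ^ k * orbit-gain b)
          (trans (∑∑-∑-comm k (λ b h → gain (translate b h)))
            (trans (∑-cong λ h → ∑∑-translate k gain h) (∑-const {p} (∑∑ k gain)))) ≤b)

      -- Croot–Sisask: translates of S = 1_S ∗ 1_S by the support of w are all close to one function u.
      almost-periods : 0ℤ < P → 0ℤ < + k → 0ℤ < σ → ∃₂ λ (u w : Fin p → ℤ) → Bits w ×
        P * σ ^ k ≤ + 2 * P ^ k * ∑ w ×
        (∑ λ h → w h * (∑ λ x → sq (+ k * conv s s (x ⊕ h) - u x))) ≤ C * ∑ w ×
        (∑ λ x → sq (+ k * conv s s x - u x)) ≤ C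
      almost-periods 0<P 0<k 0<σ = sample a , w , w∈ , large , on-average , at-zero
        where
        b₀ : Tuple k
        b₀ = proj₁ good-orbit

        g₀ : Fin p
        g₀ = proj₁ (∑-≤-max 𝟎 (λ h → gain (translate b₀ h)))

        -- The best point of the orbit becomes its origin: the total over the orbit yields `large`
        -- and `on-average`, and the positive gain of a itself yields `at-zero`.
        a : Tuple k
        a = translate b₀ g₀

        w e : Fin p → ℤ
        w h = weight (translate a h)
        e h = ∑ λ x → sq (+ k * S (x ⊕ h) - sample a x)

        w∈ : Bits w
        w∈ h = weight∈ (translate a h)

        K : ℤ
        K = + k * (σ * σ * σ)

        0<K : 0ℤ < K
        0<K = 0<* 0<k (0<* (0<* 0<σ 0<σ) 0<σ)

        good : P * (K * σ ^ k) ≤ P ^ k * orbit-gain a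
        good = subst (λ o → P * (K * σ ^ k) ≤ P ^ k * o) (sym (orbit-gain-translate b₀ g₀)) (proj₂ good-orbit)

        0<orbit : 0ℤ < orbit-gain a
        0<orbit = 0<ʳ (0≤^ k (<⇒≤ 0<P)) (<-≤-trans (0<* 0<P (0<* 0<K (0<^ k 0<σ))) good)

        orbit-value : orbit-gain a ≡ C * ∑ w - ∑ (λ h → w h * e h)
        orbit-value = trans (∑-cong λ h → trans (cong (λ t → w h * (C - t)) (total-error-translate a h))
            (aux (w h) C (e h)))
          (trans (∑-- {p} _ _) (cong (_- ∑ λ h → w h * e h) (∑-*ˡ C w)))
          where
          aux : ∀ w C e → w * (C - e) ≡ C * w - w * e
          aux = solve-∀

        on-average : ∑ (λ h → w h * e h) ≤ C * ∑ w
        on-average = by-difference (<⇒≤ 0<orbit) (sym orbit-value)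

        -- Each h in H contributes at most C to the orbit's gain, so a large gain forces a large H.
        large : P * σ ^ k ≤ + 2 * P ^ k * ∑ w
        large = cancelˡ-≤ 0<K (≤-trans (≤-reflexive (aux₁ P K (σ ^ k))) (≤-trans good
          (≤-trans (*-monoˡ (0≤^ k (<⇒≤ 0<P)) orbit≤) (≤-reflexive (aux₂ (P ^ k) (+ k) (σ * σ * σ) (∑ w))))))
          where
          aux₁ : ∀ P K t → K * (P * t) ≡ P * (K * t)
          aux₁ = solve-∀
          aux₂ : ∀ q k c W → q * (+ 2 * k * c * W) ≡ k * c * (+ 2 * q * W)
          aux₂ = solve-∀
          orbit≤ : orbit-gain a ≤ C * ∑ w
          orbit≤ = by-difference (∑-nonneg λ h → 0≤* (bit-≥0 (w∈ h)) (∑-nonneg λ x → 0≤sq (+ k * S (x ⊕ h) - sample a x)))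
            (trans (cong (_-_ (C * ∑ w)) orbit-value) (cancel (C * ∑ w) (∑ λ h → w h * e h)))
            where
            cancel : ∀ x y → x - (x - y) ≡ y
            cancel = solve-∀

        0<gain : 0ℤ < gain a
        0<gain = 0<ʳ (<⇒≤ 0<P) (<-≤-trans (subst (0ℤ <_) (orbit-gain-translate b₀ g₀) 0<orbit)
          (proj₂ (∑-≤-max 𝟎 (λ h → gain (translate b₀ h)))))

        at-zero : ∑ (λ x → sq (+ k * S x - sample a x)) ≤ C
        at-zero = by-difference (<⇒≤ (0<ʳ (bit-≥0 (weight∈ a)) 0<gain)) refl

-- Solutions of x + y = z counted with smoothed indicators.

module SmoothedCount {p} (F : PrimeFields.PrimeField p) where

  open PrimeFields.PrimeField F
  open IntegerSums
  open Pollard F using (∑-shift; conv)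
  open import Data.Fin.Base using (Fin)
  open import Data.Integer hiding (suc; _⊖_)
  open import Data.Integer.Properties
  open import Data.Integer.Tactic.RingSolver using (solve-∀)
  import Data.Nat.Base as ℕ
  open import Data.Sum.Base using (inj₁; inj₂)
  open import Function.Base using (_∘_; _∋_)
  open import Relation.Binary.PropositionalEquality

  smooth : (w s : Fin p → ℤ) → Fin p → ℤ
  smooth w s x = ∑ λ h → w h * s (x ⊕ h)

  smooth-count : (w s : Fin p → ℤ) → ℤ
  smooth-count w s = ∑ λ x → ∑ λ y → smooth w s x * smooth w s y * smooth w s (x ⊕ y)

  module _ (s w : Fin p → ℤ) where

    -- The number of (x, y, z) ∈ S³ with x + y = z + h₁ + h₂ − h₃.
    shifted-count : (h₁ h₂ h₃ : Fin p) → ℤ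
    shifted-count h₁ h₂ h₃ = ∑ λ z → s z * conv s s (z ⊕ (h₂ ⊖ h₃) ⊕ h₁)

    private
      N : Fin p → ℤ
      N = smooth w s

      pull : ∀ (g : Fin p → Fin p → ℤ) (t : Fin p → Fin p → Fin p → ℤ) →
        (∑ λ x → ∑ λ y → g x y * (∑ λ h → w h * t h x y)) ≡ ∑ λ h → w h * (∑ λ x → ∑ λ y → g x y * t h x y)
      pull g t = trans (∑-cong λ x → trans
          (∑-cong λ y → trans (sym (∑-*ˡ (g x y) (λ h → w h * t h x y))) (∑-cong λ h → aux (g x y) (w h) (t h x y)))
          (∑-comm (λ y h → w h * (g x y * t h x y))))
        (trans (∑-comm (λ x h → ∑ λ y → w h * (g x y * t h x y)))
        (∑-cong λ h → trans (∑-cong λ x → ∑-*ˡ (w h) (λ y → g x y * t h x y))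
          (∑-*ˡ (w h) (λ x → ∑ λ y → g x y * t h x y))))
        where
        aux : ∀ g w t → g * (w * t) ≡ w * (g * t)
        aux = solve-∀

      ∑∑-cong₂ : ∀ {f g : Fin p → Fin p → ℤ} → (∀ x y → f x y ≡ g x y) →
                 (∑ λ x → ∑ λ y → f x y) ≡ ∑ λ x → ∑ λ y → g x y
      ∑∑-cong₂ e = ∑-cong λ x → ∑-cong λ y → e x y

      count-form : ∀ h₁ h₂ h₃ →
        (∑ λ x → ∑ λ y → s (x ⊕ y ⊕ h₃) * s (y ⊕ h₂) * s (x ⊕ h₁)) ≡ shifted-count h₁ h₂ h₃
      count-form h₁ h₂ h₃ = trans (∑-cong λ x → trans
          (∑-cong λ y → cong₂ (λ z z′ → s z * s z′ * s (x ⊕ h₁))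
            (solve 3 (λ x y h₃ → x :+ y :+ h₃ := y :+ (x :+ h₃)) refl x y h₃)
            (solve 4 (λ x y h₂ h₃ → y :+ h₂ := y :+ (x :+ h₃) :- (x :+ h₃) :+ h₂) refl x y h₂ h₃))
          (∑-shift (x ⊕ h₃) (λ z → s z * s (z ⊖ (x ⊕ h₃) ⊕ h₂) * s (x ⊕ h₁))))
        (trans (∑-comm (λ x z → s z * s (z ⊖ (x ⊕ h₃) ⊕ h₂) * s (x ⊕ h₁)))
        (∑-cong λ z → trans (∑-cong λ x → trans
            (cong (λ v → s z * s v * s (x ⊕ h₁))
              (solve 5 (λ x z h₁ h₂ h₃ → z :- (x :+ h₃) :+ h₂ := z :+ (h₂ :- h₃) :+ h₁ :- (x :+ h₁)) refl x z h₁ h₂ h₃))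
            (aux (s z) (s (z ⊕ (h₂ ⊖ h₃) ⊕ h₁ ⊖ (x ⊕ h₁))) (s (x ⊕ h₁))))
          (trans (∑-shift h₁ (λ a → s z * (s a * s (z ⊕ (h₂ ⊖ h₃) ⊕ h₁ ⊖ a))))
            (∑-*ˡ (s z) (λ a → s a * s (z ⊕ (h₂ ⊖ h₃) ⊕ h₁ ⊖ a))))))
        where
        aux : ∀ a b c → a * b * c ≡ a * (c * b)
        aux = solve-∀

    smooth-count-expand : smooth-count w s ≡
      ∑ λ h₃ → w h₃ * (∑ λ h₂ → w h₂ * (∑ λ h₁ → w h₁ * shifted-count h₁ h₂ h₃))
    smooth-count-expand = trans (pull (λ x y → N x * N y) (λ h x y → s (x ⊕ y ⊕ h)))
      (∑-cong λ h₃ → cong (w h₃ *_) (trans (∑∑-cong₂ λ x y → aux₁ (N x) (N y) (s (x ⊕ y ⊕ h₃)))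
        (trans (pull (λ x y → s (x ⊕ y ⊕ h₃) * N x) (λ h x y → s (y ⊕ h)))
      (∑-cong λ h₂ → cong (w h₂ *_) (trans (∑∑-cong₂ λ x y → aux₂ (s (x ⊕ y ⊕ h₃)) (N x) (s (y ⊕ h₂)))
        (trans (pull (λ x y → s (x ⊕ y ⊕ h₃) * s (y ⊕ h₂)) (λ h x y → s (x ⊕ h)))
      (∑-cong λ h₁ → cong (w h₁ *_) (count-form h₁ h₂ h₃))))))))
      where
      aux₁ : ∀ a b c → a * b * c ≡ c * a * b
      aux₁ = solve-∀
      aux₂ : ∀ a b c → a * b * c ≡ a * c * b
      aux₂ = solve-∀

  module _ (s w u : Fin p → ℤ) (s∈ : Bits s) (w∈ : Bits w) (K C : ℤ)
           (sum-free : ∀ z → s z * conv s s z ≡ 0ℤ)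
           (on-average : (∑ λ h → w h * (∑ λ x → sq (K * conv s s (x ⊕ h) - u x))) ≤ C * ∑ w)
           (at-zero : (∑ λ x → sq (K * conv s s x - u x)) ≤ C) where

    private
      S : Fin p → ℤ
      S = conv s s

      W σ : ℤ
      W = ∑ w
      σ = ∑ s

      e : Fin p → ℤ
      e h = ∑ λ x → sq (K * S (x ⊕ h) - u x)

      e₀ : ℤ
      e₀ = ∑ λ x → sq (K * S x - u x)

      0≤W : 0ℤ ≤ W
      0≤W = ∑-nonneg (bit-≥0 ∘ w∈)

      -- S is compared at z + h₁ + h₂ − h₃ and at z through u(z + h₂ − h₃), S(z + h₂) and u(z).
      pointwise : ∀ R {σ} f f₀ u₁ f₁ u₀ → Bit σ → σ * f₀ ≡ 0ℤ →
        + 2 * R * K * (σ * f) ≤ σ * (R * R) + + 4 * (sq (K * f - u₁) + (sq (K * f₁ - u₁) + (sq (K * f₁ - u₀) + sq (K * f₀ - u₀))))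
      pointwise R f f₀ u₁ f₁ u₀ (inj₁ refl) _ = by-difference
        (0≤* {+ 4} (+≤+ ℕ.z≤n) (0≤+ (0≤sq (K * f - u₁)) (0≤+ (0≤sq (K * f₁ - u₁)) (0≤+ (0≤sq (K * f₁ - u₀)) (0≤sq (K * f₀ - u₀))))))
        (aux R K f (sq (K * f - u₁) + (sq (K * f₁ - u₁) + (sq (K * f₁ - u₀) + sq (K * f₀ - u₀)))))
        where
        aux : ∀ R K f q → 0ℤ * (R * R) + + 4 * q - + 2 * R * K * (0ℤ * f) ≡ + 4 * q
        aux = solve-∀
      pointwise R f f₀ u₁ f₁ u₀ (inj₂ refl) 1*f₀≡0 with trans (sym (*-identityˡ f₀)) 1*f₀≡0
      -- As S(z) = 0, telescoping gives K f = α - β + γ - δ, whence 2RKf ≤ R² + (Kf)² ≤ R² + 4(α² +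
      -- β² + γ² + δ²). The first square is the defect of AM-GM, the other six that of
      -- Cauchy-Schwarz.
      ... | refl = by-difference
        (0≤+ (0≤sq (R - (α - β + γ - δ))) (0≤+ (0≤sq (α + β)) (0≤+ (0≤sq (α - γ)) (0≤+ (0≤sq (α + δ))
          (0≤+ (0≤sq (β + γ)) (0≤+ (0≤sq (β - δ)) (0≤sq (γ + δ))))))))
        (aux R K f u₁ f₁ u₀)
        where
        α β γ δ : ℤ
        α = K * f - u₁
        β = K * f₁ - u₁
        γ = K * f₁ - u₀
        δ = K * 0ℤ - u₀
        aux : ∀ R K f u₁ f₁ u₀ →
          1ℤ * (R * R) + + 4 * ((K * f - u₁) * (K * f - u₁) + ((K * f₁ - u₁) * (K * f₁ - u₁)
            + ((K * f₁ - u₀) * (K * f₁ - u₀) + (K * 0ℤ - u₀) * (K * 0ℤ - u₀)))) - + 2 * R * K * (1ℤ * f) ≡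
          (R - (K * f - u₁ - (K * f₁ - u₁) + (K * f₁ - u₀) - (K * 0ℤ - u₀))) * (R - (K * f - u₁ - (K * f₁ - u₁) + (K * f₁ - u₀) - (K * 0ℤ - u₀)))
          + ((K * f - u₁ + (K * f₁ - u₁)) * (K * f - u₁ + (K * f₁ - u₁))
          + ((K * f - u₁ - (K * f₁ - u₀)) * (K * f - u₁ - (K * f₁ - u₀))
          + ((K * f - u₁ + (K * 0ℤ - u₀)) * (K * f - u₁ + (K * 0ℤ - u₀))
          + ((K * f₁ - u₁ + (K * f₁ - u₀)) * (K * f₁ - u₁ + (K * f₁ - u₀))
          + ((K * f₁ - u₁ - (K * 0ℤ - u₀)) * (K * f₁ - u₁ - (K * 0ℤ - u₀))
          + (K * f₁ - u₀ + (K * 0ℤ - u₀)) * (K * f₁ - u₀ + (K * 0ℤ - u₀)))))))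
        aux = solve-∀

      shifted-bound : ∀ R h₁ h₂ h₃ →
        + 2 * R * K * shifted-count s w h₁ h₂ h₃ ≤ σ * (R * R) + + 4 * (e h₁ + (e h₃ + (e h₂ + e₀)))
      shifted-bound R h₁ h₂ h₃ = subst₂ _≤_ (∑-*ˡ (+ 2 * R * K) (λ z → s z * S (v z))) total
        (∑-mono λ z → pointwise R (S (v z)) (S z) (u (z ⊕ (h₂ ⊖ h₃))) (S (z ⊕ h₂)) (u z) (s∈ z) (sum-free z))
        where
        v : Fin p → Fin p
        v z = z ⊕ (h₂ ⊖ h₃) ⊕ h₁
        α β γ δ : Fin p → ℤ
        α z = sq (K * S (v z) - u (z ⊕ (h₂ ⊖ h₃)))
        β z = sq (K * S (z ⊕ h₂) - u (z ⊕ (h₂ ⊖ h₃)))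
        γ z = sq (K * S (z ⊕ h₂) - u z)
        δ z = sq (K * S z - u z)
        ∑α : ∑ α ≡ e h₁
        ∑α = ∑-shift (h₂ ⊖ h₃) (λ x → sq (K * S (x ⊕ h₁) - u x))
        ∑β : ∑ β ≡ e h₃
        ∑β = trans (∑-cong λ z → cong (λ y → sq (K * S y - u (z ⊕ (h₂ ⊖ h₃))))
            (solve 3 (λ z h₂ h₃ → z :+ h₂ := z :+ (h₂ :- h₃) :+ h₃) refl z h₂ h₃))
          (∑-shift (h₂ ⊖ h₃) (λ x → sq (K * S (x ⊕ h₃) - u x)))
        total : (∑ λ z → s z * (R * R) + + 4 * (α z + (β z + (γ z + δ z)))) ≡
                σ * (R * R) + + 4 * (e h₁ + (e h₃ + (e h₂ + e₀)))
        total = trans (∑-+ {p} _ _) (cong₂ _+_ (∑-*ʳ (R * R) s) (trans (∑-*ˡ (+ 4) (λ z → α z + (β z + (γ z + δ z))))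
          (cong (+ 4 *_) (trans (∑-+ α _) (cong₂ _+_ ∑α (trans (∑-+ β _) (cong₂ _+_ ∑β (∑-+ γ δ))))))))

      -- Averaging over one shift replaces its error by the bound C at the cost of a factor W; A
      -- carries the terms that do not depend on this shift.
      average : ∀ {B} A {X : Fin p → ℤ} → 0ℤ ≤ B → (∀ h → X h ≤ B * (A + + 4 * e h)) →
                ∑ (λ h → w h * X h) ≤ B * W * (A + + 4 * C)
      average {B} A {X} 0≤B X≤ = ≤-trans (∑-mono λ h → *-monoˡ (bit-≥0 (w∈ h)) (X≤ h))
        (≤-trans (≤-reflexive (trans (∑-cong λ h → aux₁ (w h) B A (e h))
          (trans (∑-+ {p} _ _) (cong₂ _+_ (∑-*ʳ (B * A) w) (∑-*ˡ (+ 4 * B) (λ h → w h * e h))))))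
        (by-difference (0≤* (0≤* {+ 4} (+≤+ ℕ.z≤n) 0≤B) (difference on-average)) (aux₂ W B A C (∑ λ h → w h * e h))))
        where
        aux₁ : ∀ w B A e → w * (B * (A + + 4 * e)) ≡ w * (B * A) + + 4 * B * (w * e)
        aux₁ = solve-∀
        aux₂ : ∀ W B A C E → B * W * (A + + 4 * C) - (W * (B * A) + + 4 * B * E) ≡ + 4 * B * (C * W - E)
        aux₂ = solve-∀

    -- The term 16 C gathers four comparisons of weight 4, three averaged over H and one at shift 0.
    -- R is the free parameter of AM-GM, left for the application to optimise.
    smooth-count-bound : ∀ R → + 2 * R * K * smooth-count w s ≤ W * W * W * (σ * (R * R) + + 16 * C)
    smooth-count-bound R = subst₂ _≤_ (sym scale) (cong₂ _*_ (cong (λ t → t * W * W) (*-identityˡ W)) (aux (σ * (R * R)) C))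
      (average (σ * (R * R) + + 4 * C + + 4 * C + + 4 * C) (0≤* (0≤* {1ℤ} (+≤+ ℕ.z≤n) 0≤W) 0≤W) λ h₃ →
        subst (_ ≤_) (cong (1ℤ * W * W *_) (aux₁ (σ * (R * R)) C (e h₃)))
          (average (σ * (R * R) + + 4 * e h₃ + + 4 * C + + 4 * C) (0≤* {1ℤ} (+≤+ ℕ.z≤n) 0≤W) λ h₂ →
            subst (_ ≤_) (cong (1ℤ * W *_) (aux₂ (σ * (R * R)) C (e h₃) (e h₂)))
              (average (σ * (R * R) + + 4 * e h₃ + + 4 * e h₂ + + 4 * C) {λ h₁ → + 2 * R * K * shifted-count s w h₁ h₂ h₃}
                (+≤+ {0} {1} ℕ.z≤n) λ h₁ →
                ≤-trans (shifted-bound R h₁ h₂ h₃)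
                  (by-difference (0≤* {+ 4} (+≤+ ℕ.z≤n) (difference at-zero)) (aux₃ (σ * (R * R)) C (e h₁) (e h₂) (e h₃) e₀)))))
      where
      aux : ∀ a C → a + + 4 * C + + 4 * C + + 4 * C + + 4 * C ≡ a + + 16 * C
      aux = solve-∀
      aux₁ : ∀ a C e₃ → a + + 4 * e₃ + + 4 * C + + 4 * C + + 4 * C ≡ a + + 4 * C + + 4 * C + + 4 * C + + 4 * e₃
      aux₁ = solve-∀
      aux₂ : ∀ a C e₃ e₂ → a + + 4 * e₃ + + 4 * e₂ + + 4 * C + + 4 * C ≡ a + + 4 * e₃ + + 4 * C + + 4 * C + + 4 * e₂
      aux₂ = solve-∀
      aux₃ : ∀ a C e₁ e₂ e₃ e₀ → 1ℤ * (a + + 4 * e₃ + + 4 * e₂ + + 4 * C + + 4 * e₁) - (a + + 4 * (e₁ + (e₃ + (e₂ + e₀)))) ≡ + 4 * (C - e₀)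
      aux₃ = solve-∀
      c : ℤ
      c = + 2 * R * K
      swap : ∀ h (f : ℤ) → c * (w h * f) ≡ w h * (c * f)
      swap h f = ((∀ c w f → c * (w * f) ≡ w * (c * f)) ∋ solve-∀) c (w h) f
      push : ∀ (f g : Fin p → ℤ) → (∀ h → c * f h ≡ g h) → c * ∑ (λ h → w h * f h) ≡ ∑ λ h → w h * g h
      push f g f≡g = trans (sym (∑-*ˡ c (λ h → w h * f h)))
        (∑-cong λ h → trans (swap h (f h)) (cong (w h *_) (f≡g h)))
      scale : c * smooth-count w s ≡
              ∑ λ h₃ → w h₃ * (∑ λ h₂ → w h₂ * (∑ λ h₁ → w h₁ * (c * shifted-count s w h₁ h₂ h₃)))
      scale = trans (cong (c *_) (smooth-count-expand s w))
        (push _ _ λ h₃ → push _ _ λ h₂ → push _ _ λ h₁ → refl)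

-- The level set of the smoothed S and the contradiction.

module SumFreeDensity {p} (F : PrimeFields.PrimeField p) where

  open PrimeFields.PrimeField F
  open IntegerSums
  open Pollard F using (∑-shift; conv; schur-count)
  open Equidistribution F using (variance-bound)
  open AlmostPeriods F using (almost-periods)
  open SmoothedCount F using (smooth; smooth-count; smooth-count-bound)
  open import Data.Empty using (⊥)
  open import Data.Fin.Base using (Fin)
  open import Data.Integer hiding (suc; _⊖_)
  open import Data.Integer.Properties
  open import Data.Integer.Tactic.RingSolver using (solve-∀)
  open import Data.Nat.Base as ℕ using (ℕ; suc; zero)
  open import Data.Product.Base using (∃₂; _×_; _,_)
  open import Data.Sum.Base using (inj₁; inj₂)
  open import Function.Base using (_∘_; _∋_)
  open import Relation.Binary.PropositionalEquality
  open import Relation.Nullary using (Dec; yes; no)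

  private
    P : ℤ
    P = + p

    indicator : ∀ {A : Set} → Dec A → ℤ
    indicator (yes _) = 1ℤ
    indicator (no _)  = 0ℤ

    indicator∈ : ∀ {A} (A? : Dec A) → Bit (indicator A?)
    indicator∈ (yes _) = inj₂ refl
    indicator∈ (no _)  = inj₁ refl

  ∑-smooth : ∀ w s → ∑ (smooth w s) ≡ ∑ w * ∑ s
  ∑-smooth w s = trans (∑-comm (λ x h → w h * s (x ⊕ h)))
    (trans (∑-cong λ h → trans (∑-*ˡ (w h) (λ x → s (x ⊕ h))) (cong (w h *_) (∑-shift h s))) (∑-*ʳ (∑ s) w))

  module LevelSet
    (s γ w : Fin p → ℤ) (s∈ : Bits s) (γ∈ : Bits γ) (w∈ : Bits w) (s≤γ : ∀ x → s x ≤ γ x)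
    (γ-inv : ∀ l → γ l ≡ 1ℤ → l ≢ 𝟎 × (∀ x → γ (l ⊗ x) ≡ γ x))
    (0<n : 0ℤ < ∑ γ) (0<W : 0ℤ < ∑ w) (j : ℤ) (0≤j : 0ℤ ≤ j)
    (w-large : j * j * (P * P) ≤ + 2 * (∑ γ * ∑ γ) * ∑ w) where

    private
      n W B : ℤ
      n = ∑ γ
      W = ∑ w
      B = n * W

      0<B : 0ℤ < B
      0<B = 0<* 0<n 0<W

      Δ : Fin p → ℤ
      Δ x = P * smooth w γ x - B

      high? : ∀ x → Dec (B ≤ j * P * smooth w s x)
      high? x = B ≤? j * P * smooth w s x

    -- Where the smoothed S reaches the fraction 1/j of nW/P, the mean of the smoothed Γ.
    level : Fin p → ℤ
    level x = indicator (high? x)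

    level∈ : Bits level
    level∈ x = indicator∈ (high? x)

    smooth≥0 : ∀ x → 0ℤ ≤ smooth w s x
    smooth≥0 x = ∑-nonneg λ h → 0≤* (bit-≥0 (w∈ h)) (bit-≥0 (s∈ (x ⊕ h)))

    level-≤ : ∀ x → level x * B ≤ j * P * smooth w s x
    level-≤ x with high? x
    ... | yes B≤ = subst (_≤ j * P * smooth w s x) (sym (*-identityˡ B)) B≤
    ... | no _   = subst (_≤ j * P * smooth w s x) (sym (*-zeroˡ B))
      (0≤* (0≤* {b = P} 0≤j (+≤+ ℕ.z≤n)) (smooth≥0 x))

    private
      smooth≤ : ∀ x → smooth w s x ≤ smooth w γ x
      smooth≤ x = ∑-mono λ h → *-monoˡ (bit-≥0 (w∈ h)) (s≤γ (x ⊕ h))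

      -- On the level set, S is bounded by Γ, and the excess Δ over the mean is absorbed through
      -- 2jBΔ ≤ B² + j²Δ². Off it, j P N(x) < B. The allowance 2B² covers both cases.
      pointwise : ∀ x → + 2 * j * B * (P * smooth w s x) ≤
                        + 2 * j * (B * B) * level x + (+ 2 * (B * B) + j * j * sq (Δ x))
      pointwise x with high? x
      ... | yes _ = by-difference
          (0≤+ (0≤* (0≤* (0≤* {+ 2} (+≤+ ℕ.z≤n) 0≤j) (<⇒≤ 0<B)) (difference (*-monoˡ {P} (+≤+ ℕ.z≤n) (smooth≤ x))))
          (0≤+ (0≤sq (B - j * Δ x)) (0≤sq B)))
          (aux j B (P * smooth w s x) (P * smooth w γ x))
        where
        aux : ∀ j B X Y → + 2 * j * (B * B) * 1ℤ + (+ 2 * (B * B) + j * j * ((Y - B) * (Y - B))) - + 2 * j * B * X ≡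
                          + 2 * j * B * (Y - X) + ((B - j * (Y - B)) * (B - j * (Y - B)) + B * B)
        aux = solve-∀
      ... | no low = by-difference
          (0≤+ (0≤* (0≤* {+ 2} (+≤+ ℕ.z≤n) (<⇒≤ 0<B)) (difference (<⇒≤ (≰⇒> low)))) (0≤sq (j * Δ x)))
          (aux j B P (smooth w s x) (Δ x))
        where
        aux : ∀ j B P N D → + 2 * j * (B * B) * 0ℤ + (+ 2 * (B * B) + j * j * (D * D)) - + 2 * j * B * (P * N) ≡
                          + 2 * B * (B - j * P * N) + j * D * (j * D)
        aux = solve-∀

      variance : ∑ (sq ∘ Δ) ≤ P * P * P * W
      variance = subst (_≤ P * P * P * W)
        (∑-cong λ d → cong (λ t → sq (P * t - B)) (∑-cong λ h → cong (λ y → w h * γ y)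
          (solve 2 (λ h d → h :+ d := d :+ h) refl h d)))
        (variance-bound γ w γ∈ w∈ 0<n γ-inv)

      summed : + 2 * j * B * (P * (W * ∑ s)) ≤
               + 2 * j * (B * B) * ∑ level + (P * (+ 2 * (B * B)) + j * j * ∑ (sq ∘ Δ))
      summed = subst₂ _≤_
        (trans (∑-*ˡ (+ 2 * j * B) (λ x → P * smooth w s x)) (cong (+ 2 * j * B *_)
          (trans (∑-*ˡ P (smooth w s)) (cong (P *_) (∑-smooth w s)))))
        (trans (∑-+ {p} _ _) (cong₂ _+_ (∑-*ˡ (+ 2 * j * (B * B)) level)
          (trans (∑-+ {p} _ _) (cong₂ _+_ (∑-const {p} (+ 2 * (B * B))) (∑-*ˡ (j * j) (sq ∘ Δ))))))
        (∑-mono pointwise)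

    -- After summation the allowance 2B² costs 2PB²; `w-large` is the size of H at which j² times
    -- the variance bound costs no more than that. The level set thus has density at least |S|/|Γ| -
    -- 2/j.
    level-dense : j * P * ∑ s ≤ j * n * ∑ level + + 2 * n * P
    level-dense = cancelˡ-≤ (0<* (0<* (+<+ {0} {2} (ℕ.s≤s ℕ.z≤n)) 0<B) 0<W) (by-difference
      (0≤+ (difference summed) (0≤+ (0≤* (0≤sq j) (difference variance))
        (0≤* (0≤* {P} (+≤+ ℕ.z≤n) (<⇒≤ 0<W)) (difference w-large′))))
      (aux j P n W (∑ s) (∑ level) (∑ (sq ∘ Δ))))
      where
      w-large′ : j * j * (P * P) ≤ + 2 * n * n * W
      w-large′ = subst (λ t → j * j * (P * P) ≤ t * W) (sym (*-assoc (+ 2) n n)) w-large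
      aux : ∀ j P n W s l v →
        + 2 * (n * W) * W * (j * n * l + + 2 * n * P) - + 2 * (n * W) * W * (j * P * s) ≡
        + 2 * j * (n * W * (n * W)) * l + (P * (+ 2 * (n * W * (n * W))) + j * j * v) - + 2 * j * (n * W) * (P * (W * s))
        + (j * j * (P * P * P * W - v) + P * W * (+ 2 * n * n * W - j * j * (P * P)))
      aux = solve-∀

    -- Each triple x, y, x + y in the level set contributes at least (B/(jP))³ to the smoothed
    -- count.
    level-schur : B * B * B * (∑ λ z → level z * conv level level z) ≤ j * P * (j * P) * (j * P) * smooth-count w s
    level-schur = subst₂ _≤_ left right (∑-mono λ x → ∑-mono λ y → pointwise₃ x y)
      where
      N : Fin p → ℤ
      N = smooth w s
      0≤jP : 0ℤ ≤ j * P
      0≤jP = 0≤* {j} {P} 0≤j (+≤+ ℕ.z≤n)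
      0≤aB : ∀ x → 0ℤ ≤ level x * B
      0≤aB x = 0≤* (bit-≥0 (level∈ x)) (<⇒≤ 0<B)
      0≤jPN : ∀ x → 0ℤ ≤ j * P * N x
      0≤jPN x = 0≤* 0≤jP (smooth≥0 x)
      pointwise₃ : ∀ x y → level x * B * (level y * B) * (level (x ⊕ y) * B) ≤
                           j * P * N x * (j * P * N y) * (j * P * N (x ⊕ y))
      pointwise₃ x y = *-mono (0≤* (0≤aB x) (0≤aB y)) (0≤jPN (x ⊕ y))
        (*-mono (0≤aB x) (0≤jPN y) (level-≤ x) (level-≤ y)) (level-≤ (x ⊕ y))
      right : (∑ λ x → ∑ λ y → j * P * N x * (j * P * N y) * (j * P * N (x ⊕ y))) ≡ j * P * (j * P) * (j * P) * smooth-count w s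
      right = trans (∑-cong λ x → trans (∑-cong λ y → aux (j * P) (N x) (N y) (N (x ⊕ y)))
          (∑-*ˡ (j * P * (j * P) * (j * P)) (λ y → N x * N y * N (x ⊕ y))))
        (∑-*ˡ (j * P * (j * P) * (j * P)) (λ x → ∑ λ y → N x * N y * N (x ⊕ y)))
        where
        aux : ∀ c a b d → c * a * (c * b) * (c * d) ≡ c * c * c * (a * b * d)
        aux = solve-∀
      left : (∑ λ x → ∑ λ y → level x * B * (level y * B) * (level (x ⊕ y) * B)) ≡ B * B * B * (∑ λ z → level z * conv level level z)
      left = trans (∑-cong λ x → trans (∑-cong λ y → trans
            (cong₂ (λ y′ z → level x * B * (level y′ * B) * (level z * B))
              (solve 2 (λ x y → y := y :+ x :- x) refl x y) (solve 2 (λ x y → x :+ y := y :+ x) refl x y))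
            (aux B (level x) (level (y ⊕ x ⊖ x)) (level (y ⊕ x))))
          (∑-shift x (λ z → B * B * B * (level z * (level x * level (z ⊖ x))))))
        (trans (∑-comm (λ x z → B * B * B * (level z * (level x * level (z ⊖ x)))))
        (trans (∑-cong λ z → trans (∑-*ˡ (B * B * B) (λ x → level z * (level x * level (z ⊖ x))))
            (cong (B * B * B *_) (∑-*ˡ (level z) (λ x → level x * level (z ⊖ x)))))
          (∑-*ˡ (B * B * B) (λ z → level z * conv level level z))))
        where
        aux : ∀ B a b c → a * B * (b * B) * (c * B) ≡ B * B * B * (c * (a * b))
        aux = solve-∀

  private
    ^-≤-* : ∀ {x a b} k → 0ℤ < x → 0ℤ < a → 0ℤ < b → x ≤ a * b → x ^ k ≤ a ^ k * b ^ k
    ^-≤-* zero    _   _   _   _    = ≤-refl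
    ^-≤-* {x} {a} {b} (suc k) 0<x 0<a 0<b x≤ab =
      ≤-trans (*-mono (<⇒≤ 0<x) (<⇒≤ (0<* (0<^ k 0<a) (0<^ k 0<b))) x≤ab (^-≤-* k 0<x 0<a 0<b x≤ab))
              (≤-reflexive (((∀ a b s t → a * b * (s * t) ≡ a * s * (b * t)) ∋ solve-∀) a b (a ^ k) (b ^ k)))

  -- The sampling parameter k = 2κ² makes 32k the square (8κ)², so that optimising the
  -- bound of smooth-count-bound at R = 8κσ gives κ Q ≤ 4σ²W³ for the smoothed count Q.
  no-dense-sum-free-subset :
    (s γ : Fin p → ℤ) → Bits s → Bits γ → (∀ x → s x ≤ γ x) →
    (∀ l → γ l ≡ 1ℤ → l ≢ 𝟎 × (∀ x → γ (l ⊗ x) ≡ γ x)) →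
    (∀ z → s z * conv s s z ≡ 0ℤ) →
    (q κ : ℕ) (M τ : ℤ) → 0ℤ < P → 1ℤ ≤ M → 1ℤ ≤ τ → + 2 * M * τ ≤ P → P ≤ + 4 * M * τ →
    P ≤ + q * ∑ s →
    + 64 * (M * M) * (+ 3 * M * (+ 3 * M) * (+ 3 * M)) * + q < + κ →
    (+ q) ^ (2 ℕ.* (κ ℕ.* κ)) * (+ 3 * M * (+ 3 * M) * (+ q * + q)) ≤ P →
    (M + + 3) * ∑ γ ≤ + 3 * M * ∑ s → ⊥
  no-dense-sum-free-subset s γ s∈ γ∈ s≤γ γ-inv sum-free q κ M τ 0<P 1≤M 1≤τ 2Mτ≤P P≤4Mτ P≤qσ κ-large p-large dense =
    from-almost-periods (almost-periods s s∈ k 0<P 0<K 0<σ)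
    where
    k : ℕ
    k = 2 ℕ.* (κ ℕ.* κ)
    n σ j Q : ℤ
    n = ∑ γ
    σ = ∑ s
    j = + 3 * M
    Q = + q

    0<1 : 0ℤ < 1ℤ
    0<1 = +<+ (ℕ.s≤s ℕ.z≤n)
    0≤n′ : ∀ m → 0ℤ ≤ + m
    0≤n′ m = +≤+ ℕ.z≤n

    σ≤n : σ ≤ n
    σ≤n = ∑-mono s≤γ
    0<σ : 0ℤ < σ
    0<σ = 0<ʳ (0≤n′ q) (<-≤-trans 0<P P≤qσ)
    0<n : 0ℤ < n
    0<n = <-≤-trans 0<σ σ≤n
    0<Q : 0ℤ < Q
    0<Q = 0<ˡ (<⇒≤ 0<σ) (<-≤-trans 0<P P≤qσ)
    0<M : 0ℤ < M
    0<M = <-≤-trans 0<1 1≤M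
    0<j : 0ℤ < j
    0<j = 0<* {+ 3} (+<+ (ℕ.s≤s ℕ.z≤n)) 0<M
    0<τ : 0ℤ < τ
    0<τ = <-≤-trans 0<1 1≤τ
    0<κ : 0ℤ < + κ
    0<κ = ≤-<-trans (<⇒≤ (0<* (0<* (0<* {+ 64} (+<+ (ℕ.s≤s ℕ.z≤n)) (0<* 0<M 0<M)) (0<* (0<* 0<j 0<j) 0<j)) 0<Q)) κ-large
    k≡2κ² : + k ≡ + 2 * (+ κ * + κ)
    k≡2κ² = trans (pos-* 2 (κ ℕ.* κ)) (cong (+ 2 *_) (pos-* κ κ))
    0<K : 0ℤ < + k
    0<K = subst (0ℤ <_) (sym k≡2κ²) (0<* {+ 2} (+<+ (ℕ.s≤s ℕ.z≤n)) (0<* 0<κ 0<κ))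
    P≤Qn : P ≤ Q * n
    P≤Qn = ≤-trans P≤qσ (*-monoˡ (0≤n′ q) σ≤n)

    from-almost-periods : (∃₂ λ (u w : Fin p → ℤ) → Bits w ×
        P * σ ^ k ≤ + 2 * P ^ k * ∑ w ×
        (∑ λ h → w h * (∑ λ x → sq (+ k * conv s s (x ⊕ h) - u x))) ≤ + 2 * + k * (σ * σ * σ) * ∑ w ×
        (∑ λ x → sq (+ k * conv s s x - u x)) ≤ + 2 * + k * (σ * σ * σ)) → ⊥
    from-almost-periods (u , w , w∈ , large , on-average , at-zero) = <⇒≱ κ-large κ-small
      where
      W : ℤ
      W = ∑ w

      P≤2QᵏW : P ≤ + 2 * Q ^ k * W
      P≤2QᵏW = cancelˡ-≤ (0<^ k 0<σ) (≤-trans (≤-reflexive (*-comm (σ ^ k) P)) (≤-trans large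
        (≤-trans (*-monoʳ (∑-nonneg (bit-≥0 ∘ w∈)) (*-monoˡ (0≤n′ 2) (^-≤-* k 0<P 0<Q 0<σ P≤qσ)))
        (≤-reflexive (aux (Q ^ k) (σ ^ k) W)))))
        where
        aux : ∀ a b W → + 2 * (a * b) * W ≡ b * (+ 2 * a * W)
        aux = solve-∀

      0<W : 0ℤ < W
      0<W = 0<ʳ (<⇒≤ (0<* {+ 2} (+<+ (ℕ.s≤s ℕ.z≤n)) (0<^ k 0<Q))) (<-≤-trans 0<P P≤2QᵏW)

      j²Q²≤2W : j * j * (Q * Q) ≤ + 2 * W
      j²Q²≤2W = cancelˡ-≤ (0<^ k 0<Q) (≤-trans p-large (≤-trans P≤2QᵏW (≤-reflexive (aux (Q ^ k) W))))
        where
        aux : ∀ a W → + 2 * a * W ≡ a * (+ 2 * W)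
        aux = solve-∀

      w-large : j * j * (P * P) ≤ + 2 * (n * n) * W
      w-large = ≤-trans (*-monoˡ (0≤sq j) (*-mono (<⇒≤ 0<P) (<⇒≤ (0<* 0<Q 0<n)) P≤Qn P≤Qn))
        (≤-trans (≤-reflexive (aux₁ j Q n)) (≤-trans (*-monoʳ (0≤sq n) j²Q²≤2W) (≤-reflexive (aux₂ n W))))
        where
        aux₁ : ∀ j Q n → j * j * (Q * n * (Q * n)) ≡ j * j * (Q * Q) * (n * n)
        aux₁ = solve-∀
        aux₂ : ∀ n W → + 2 * W * (n * n) ≡ + 2 * (n * n) * W
        aux₂ = solve-∀

      open LevelSet s γ w s∈ γ∈ w∈ s≤γ γ-inv 0<n 0<W j (<⇒≤ 0<j) w-large

      l T q₃ : ℤ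
      l = ∑ level
      T = ∑ λ z → level z * conv level level z
      q₃ = smooth-count w s

      -- With j = 3M the density 1/3 + 1/M of S in Γ drops by 2/(3M), leaving 1/3 + 1/(3M).
      level-size : (M + 1ℤ) * P ≤ + 3 * M * l
      level-size = cancelˡ-≤ 0<n (by-difference
        (0≤+ (difference level-dense) (0≤* (<⇒≤ 0<P) (difference dense))) (aux M P n σ l))
        where
        aux : ∀ M P n σ l → n * (+ 3 * M * l) - n * ((M + 1ℤ) * P) ≡
          + 3 * M * n * l + + 2 * n * P - + 3 * M * P * σ + P * (+ 3 * M * σ - (M + + 3) * n)
        aux = solve-∀

      P+2τ≤3l : P + (τ + τ) ≤ + 3 * l
      P+2τ≤3l = cancelˡ-≤ 0<M (by-difference (0≤+ (difference level-size) (difference 2Mτ≤P)) (aux M P τ l))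
        where
        aux : ∀ M P τ l → M * (+ 3 * l) - M * (P + (τ + τ)) ≡ + 3 * M * l - (M + 1ℤ) * P + (P - + 2 * M * τ)
        aux = solve-∀

      τ≤P : τ ≤ P
      τ≤P = ≤-trans (by-difference (0≤+ (0≤* (0≤* {+ 2} (0≤n′ 2) (<⇒≤ 0<τ)) (difference 1≤M)) (<⇒≤ 0<τ)) (aux M τ)) 2Mτ≤P
        where
        aux : ∀ M τ → + 2 * M * τ - τ ≡ + 2 * τ * (M - 1ℤ) + τ
        aux = solve-∀

      P²≤16M²T : P * P ≤ + 16 * (M * M) * T
      P²≤16M²T = ≤-trans (*-mono (<⇒≤ 0<P) (≤-trans (<⇒≤ 0<P) P≤4Mτ) P≤4Mτ P≤4Mτ)
        (≤-trans (≤-reflexive (aux M τ)) (*-monoˡ (0≤* {+ 16} (0≤n′ 16) (0≤sq M)) (schur-count level τ level∈ 1≤τ τ≤P P+2τ≤3l)))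
        where
        aux : ∀ M τ → + 4 * M * τ * (+ 4 * M * τ) ≡ + 16 * (M * M) * (τ * τ)
        aux = solve-∀

      κq₃≤4σ²W³ : + κ * q₃ ≤ + 4 * (σ * σ) * (W * W * W)
      κq₃≤4σ²W³ = cancelˡ-≤ (0<* (0<* {+ 32} (+<+ (ℕ.s≤s ℕ.z≤n)) (0<* 0<κ 0<κ)) 0<σ)
        (subst₂ _≤_ (aux₁ (+ κ) σ q₃) (aux₂ (+ κ) σ W)
          (subst (λ K → + 2 * (+ 8 * + κ * σ) * K * q₃ ≤ W * W * W * (σ * (+ 8 * + κ * σ * (+ 8 * + κ * σ)) + + 16 * (+ 2 * K * (σ * σ * σ)))) k≡2κ²
            (smooth-count-bound s w u s∈ w∈ (+ k) (+ 2 * + k * (σ * σ * σ)) sum-free on-average at-zero (+ 8 * + κ * σ))))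
        where
        aux₁ : ∀ κ σ q → + 2 * (+ 8 * κ * σ) * (+ 2 * (κ * κ)) * q ≡ + 32 * (κ * κ) * σ * (κ * q)
        aux₁ = solve-∀
        aux₂ : ∀ κ σ W → W * W * W * (σ * (+ 8 * κ * σ * (+ 8 * κ * σ)) + + 16 * (+ 2 * (+ 2 * (κ * κ)) * (σ * σ * σ))) ≡
                         + 32 * (κ * κ) * σ * (+ 4 * (σ * σ) * (W * W * W))
        aux₂ = solve-∀

      -- The lower and upper bounds for the smoothed count meet here: the four summands are the
      -- links of the chain, weighted so that T, q₃ and σ cancel.
      κn≤ : P * P * (n * n) * (W * W * W) * (+ κ * n) ≤ P * P * (n * n) * (W * W * W) * (+ 64 * (M * M) * (j * j * j) * P)
      κn≤ = by-difference
        (0≤+ (0≤* (0≤* (<⇒≤ 0<κ) (<⇒≤ (0<* (0<* 0<B 0<B) 0<B))) (difference P²≤16M²T))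
        (0≤+ (0≤* (0≤* (0≤* {+ 16} (0≤n′ 16) (0≤sq M)) (<⇒≤ 0<κ)) (difference level-schur))
        (0≤+ (0≤* 0≤c (difference κq₃≤4σ²W³))
             (0≤* (0≤* (0≤* {+ 4} (0≤n′ 4) 0≤c) (<⇒≤ (0<* (0<* 0<W 0<W) 0<W)))
               (difference (*-mono (<⇒≤ 0<σ) (<⇒≤ 0<n) σ≤n σ≤n))))))
        (aux P n W (+ κ) M j T q₃ σ)
        where
        0<B : 0ℤ < n * W
        0<B = 0<* 0<n 0<W
        c : ℤ
        c = + 16 * (M * M) * (j * P * (j * P) * (j * P))
        0≤c : 0ℤ ≤ c
        0≤c = 0≤* (0≤* {+ 16} (0≤n′ 16) (0≤sq M)) (<⇒≤ (0<* (0<* (0<* 0<j 0<P) (0<* 0<j 0<P)) (0<* 0<j 0<P)))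
        aux : ∀ P n W κ M j T q σ →
          P * P * (n * n) * (W * W * W) * (+ 64 * (M * M) * (j * j * j) * P) - P * P * (n * n) * (W * W * W) * (κ * n) ≡
          κ * (n * W * (n * W) * (n * W)) * (+ 16 * (M * M) * T - P * P)
          + (+ 16 * (M * M) * κ * (j * P * (j * P) * (j * P) * q - n * W * (n * W) * (n * W) * T)
          + (+ 16 * (M * M) * (j * P * (j * P) * (j * P)) * (+ 4 * (σ * σ) * (W * W * W) - κ * q)
          + + 4 * (+ 16 * (M * M) * (j * P * (j * P) * (j * P))) * (W * W * W) * (n * n - σ * σ)))
        aux = solve-∀

      κ-small : + κ ≤ + 64 * (M * M) * (j * j * j) * Q
      κ-small = cancelˡ-≤ 0<n (≤-trans (≤-reflexive (*-comm n (+ κ))) (≤-trans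
        (cancelˡ-≤ (0<* (0<* (0<* 0<P 0<P) (0<* 0<n 0<n)) (0<* (0<* 0<W 0<W) 0<W)) κn≤)
        (≤-trans (*-monoˡ (0≤* (0≤* {+ 64} (0≤n′ 64) (0≤sq M)) (<⇒≤ (0<* (0<* 0<j 0<j) 0<j))) P≤Qn)
        (≤-reflexive (aux (+ 64 * (M * M) * (j * j * j)) Q n)))))
        where
        aux : ∀ c Q n → c * (Q * n) ≡ n * (c * Q)
        aux = solve-∀

-- Logarithms and the size of p.

module Growth where

  open import Data.Nat
  open import Data.Nat.DivMod
  open import Data.Nat.Induction using (<-rec)
  open import Data.Nat.Logarithm
  open import Data.Nat.Properties
  open import Data.Nat.Tactic.RingSolver using (solve-∀)
  open import Data.Product.Base using (∃; _×_; _,_)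
  open import Function.Base using (_∋_)
  open import Relation.Binary.PropositionalEquality

  n<2^n : ∀ n → n < 2 ^ n
  n<2^n zero    = s≤s z≤n
  n<2^n (suc n) = +-mono-≤ (m^n>0 2 n) (≤-trans (n<2^n n) (m≤m+n (2 ^ n) 0))

  n<2^1+log : ∀ n → n < 2 ^ suc ⌊log₂ n ⌋
  n<2^1+log n = ≰⇒> λ 2^≤n → <-irrefl refl
    (subst (_≤ ⌊log₂ n ⌋) (⌊log₂[2^n]⌋≡n (suc ⌊log₂ n ⌋)) (⌊log₂⌋-mono-≤ 2^≤n))

  2^log≤n : ∀ n → 1 ≤ n → 2 ^ ⌊log₂ n ⌋ ≤ n
  2^log≤n = <-rec _ step
    where
    step : ∀ n → (∀ {m} → m < n → 1 ≤ m → 2 ^ ⌊log₂ m ⌋ ≤ m) → 1 ≤ n → 2 ^ ⌊log₂ n ⌋ ≤ n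
    step 1 _ _ = s≤s z≤n
    step n@(suc (suc m)) ih _ = begin
      2 ^ ⌊log₂ n ⌋               ≡⟨ cong (2 ^_) log-suc ⟨
      2 * 2 ^ ⌊log₂ ⌊ n /2⌋ ⌋     ≤⟨ *-monoʳ-≤ 2 (ih (⌊n/2⌋<n (suc m)) (s≤s z≤n)) ⟩
      2 * ⌊ n /2⌋                 ≤⟨ +-monoʳ-≤ ⌊ n /2⌋ (≤-trans (≤-reflexive (+-identityʳ ⌊ n /2⌋)) (⌊n/2⌋≤⌈n/2⌉ n)) ⟩
      ⌊ n /2⌋ + ⌈ n /2⌉           ≡⟨ ⌊n/2⌋+⌈n/2⌉≡n n ⟩
      n                           ∎
      where
      open ≤-Reasoning
      log-suc : suc ⌊log₂ ⌊ n /2⌋ ⌋ ≡ ⌊log₂ n ⌋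
      log-suc = trans (cong suc (⌊log₂⌊n/2⌋⌋≡⌊log₂n⌋∸1 n))
        (m+[n∸m]≡n (⌊log₂⌋-mono-≤ {2} {n} (s≤s (s≤s z≤n))))

  LL-≥ : ∀ {ℓ p} → 2 ^ (2 ^ ℓ) ≤ p → ℓ ≤ ⌊log₂ ⌊log₂ p ⌋ ⌋
  LL-≥ {ℓ} {p} 2^2^ℓ≤p = subst (_≤ ⌊log₂ ⌊log₂ p ⌋ ⌋) (⌊log₂[2^n]⌋≡n ℓ) (⌊log₂⌋-mono-≤
    (subst (_≤ ⌊log₂ p ⌋) (⌊log₂[2^n]⌋≡n (2 ^ ℓ)) (⌊log₂⌋-mono-≤ 2^2^ℓ≤p)))

  -- Turns the density hypothesis on Γ into an upper bound for q, which is p/|S| up to a factor 2.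
  -- In the application ℓ is the fourth power of log log p; 36 is 2² · 3², from qσ ≤ 2p and n ≤ 3σ.
  index-bound : ∀ A B ℓ Λ p n σ q → 1 ≤ A → 1 ≤ σ → q * σ ≤ 2 * p → n ≤ 3 * σ →
                A * ℓ * (p ^ 2) ≤ B * (n ^ 2) * Λ → ℓ * (q * q) ≤ 36 * B * Λ
  index-bound A B ℓ Λ p n σ@(suc _) q 1≤A 1≤σ qσ≤2p n≤3σ hyp = *-cancelʳ-≤ _ _ (σ * σ) (begin
    ℓ * (q * q) * (σ * σ)      ≡⟨ ((∀ ℓ q σ → ℓ * (q * q) * (σ * σ) ≡ ℓ * (q * σ * (q * σ))) ∋ solve-∀) ℓ q σ ⟩
    ℓ * (q * σ * (q * σ))      ≤⟨ *-monoʳ-≤ ℓ (*-mono-≤ qσ≤2p qσ≤2p) ⟩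
    ℓ * (2 * p * (2 * p))      ≡⟨ ((∀ ℓ p → ℓ * (2 * p * (2 * p)) ≡ 4 * (1 * ℓ * (p * (p * 1)))) ∋ solve-∀) ℓ p ⟩
    4 * (1 * ℓ * (p ^ 2))      ≤⟨ *-monoʳ-≤ 4 (*-monoˡ-≤ (p ^ 2) (*-monoˡ-≤ ℓ 1≤A)) ⟩
    4 * (A * ℓ * (p ^ 2))      ≤⟨ *-monoʳ-≤ 4 hyp ⟩
    4 * (B * (n ^ 2) * Λ)      ≡⟨ ((∀ B n Λ → 4 * (B * (n * (n * 1)) * Λ) ≡ 4 * B * Λ * (n * n)) ∋ solve-∀) B n Λ ⟩
    4 * B * Λ * (n * n)        ≤⟨ *-monoʳ-≤ (4 * B * Λ) (*-mono-≤ n≤3σ n≤3σ) ⟩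
    4 * B * Λ * (3 * σ * (3 * σ)) ≡⟨ ((∀ B Λ σ → 4 * B * Λ * (3 * σ * (3 * σ)) ≡ 36 * B * Λ * (σ * σ)) ∋ solve-∀) B Λ σ ⟩
    36 * B * Λ * (σ * σ)       ∎)
    where open ≤-Reasoning

  -- Instantiated with J = (3M)² and with cq + 1 the κ of no-dense-sum-free-subset.
  exponent : (c J : ℕ) → ℕ
  exponent c J = J + 2 * (2 * (suc c * suc c) + 2)

  -- The first summand absorbs the constant in log q, the second the constant in the exponent.
  threshold : (D c J : ℕ) → ℕ
  threshold D c J = suc D + D * exponent c J

  -- A crude bound on q gives log q ≤ D + 1 + ℓ ≤ 2ℓ, so the logarithm of the left side is at most E
  -- ℓ q². Since D E ≤ ℓ, this is at most ℓ² q²/D, hence at most log p by the last hypothesis.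
  p-large : ∀ D c J q p → 1 ≤ D → 1 ≤ q → 1 ≤ p → threshold D c J ≤ ⌊log₂ ⌊log₂ p ⌋ ⌋ →
            ⌊log₂ ⌊log₂ p ⌋ ⌋ ^ 4 * (q * q) ≤ D * ⌊log₂ p ⌋ →
            q ^ (2 * (suc (c * q) * suc (c * q))) * (J * (q * q)) ≤ p
  p-large D@(suc _) c J q p 1≤D 1≤q 1≤p ℓ-large hyp = begin
    q ^ k * (J * (q * q))                    ≡⟨ ((∀ x J q → x * (J * (q * q)) ≡ J * (q * (q * x))) ∋ solve-∀) (q ^ k) J q ⟩
    J * q ^ (2 + k)                          ≤⟨ *-mono-≤ (<⇒≤ (n<2^n J)) (^-monoˡ-≤ (2 + k) q≤) ⟩
    2 ^ J * (2 ^ (D + suc ℓ)) ^ (2 + k)      ≡⟨ cong (2 ^ J *_) (^-*-assoc 2 (D + suc ℓ) (2 + k)) ⟩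
    2 ^ J * 2 ^ ((D + suc ℓ) * (2 + k))      ≡⟨ ^-distribˡ-+-* 2 J _ ⟨
    2 ^ (J + (D + suc ℓ) * (2 + k))          ≤⟨ ^-monoʳ-≤ 2 (≤-trans small-exponent exponent≤Λ) ⟩
    2 ^ Λ                                    ≤⟨ 2^log≤n p 1≤p ⟩
    p                                        ∎
    where
    open ≤-Reasoning
    Λ ℓ k E : ℕ
    Λ = ⌊log₂ p ⌋
    ℓ = ⌊log₂ Λ ⌋
    k = 2 * (suc (c * q) * suc (c * q))
    E = exponent c J
    1+D≤ℓ : suc D ≤ ℓ
    1+D≤ℓ = m+n≤o⇒m≤o (suc D) ℓ-large
    DE≤ℓ : D * E ≤ ℓ
    DE≤ℓ = m+n≤o⇒n≤o (suc D) ℓ-large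
    1≤ℓ : 1 ≤ ℓ
    1≤ℓ = ≤-trans (s≤s z≤n) 1+D≤ℓ
    1≤q² : 1 ≤ q * q
    1≤q² = *-mono-≤ 1≤q 1≤q
    1≤ℓ^ : ∀ j → 1 ≤ ℓ ^ j
    1≤ℓ^ j = m^n>0 ℓ {{>-nonZero 1≤ℓ}} j
    q≤ : q ≤ 2 ^ (D + suc ℓ)
    q≤ = begin
      q                      ≤⟨ m≤m*n q q {{>-nonZero 1≤q}} ⟩
      q * q                  ≤⟨ m≤n*m (q * q) (ℓ ^ 4) {{>-nonZero (1≤ℓ^ 4)}} ⟩
      ℓ ^ 4 * (q * q)        ≤⟨ hyp ⟩
      D * Λ                  ≤⟨ *-mono-≤ (<⇒≤ (n<2^n D)) (<⇒≤ (n<2^1+log Λ)) ⟩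
      2 ^ D * 2 ^ suc ℓ      ≡⟨ ^-distribˡ-+-* 2 D (suc ℓ) ⟨
      2 ^ (D + suc ℓ)        ∎
    D+1+ℓ≤2ℓ : D + suc ℓ ≤ 2 * ℓ
    D+1+ℓ≤2ℓ = ≤-trans (≤-reflexive (+-suc D ℓ)) (≤-trans (+-monoˡ-≤ ℓ 1+D≤ℓ) (≤-reflexive (cong (ℓ +_) (sym (+-identityʳ ℓ)))))
    κ≤ : suc (c * q) ≤ suc c * q
    κ≤ = +-monoˡ-≤ (c * q) 1≤q
    2+k≤ : 2 + k ≤ (2 * (suc c * suc c) + 2) * (q * q)
    2+k≤ = begin
      2 + k                                              ≤⟨ +-mono-≤ (*-monoʳ-≤ 2 1≤q²) (*-monoʳ-≤ 2 (*-mono-≤ κ≤ κ≤)) ⟩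
      2 * (q * q) + 2 * (suc c * q * (suc c * q))        ≡⟨ ((∀ q x → 2 * (q * q) + 2 * (x * q * (x * q)) ≡ (2 * (x * x) + 2) * (q * q)) ∋ solve-∀) q (suc c) ⟩
      (2 * (suc c * suc c) + 2) * (q * q)                ∎
    small-exponent : J + (D + suc ℓ) * (2 + k) ≤ E * (ℓ * (q * q))
    small-exponent = begin
      J + (D + suc ℓ) * (2 + k)
        ≤⟨ +-mono-≤ (m≤m*n J (ℓ * (q * q)) {{>-nonZero (*-mono-≤ 1≤ℓ 1≤q²)}}) (*-mono-≤ D+1+ℓ≤2ℓ 2+k≤) ⟩
      J * (ℓ * (q * q)) + 2 * ℓ * ((2 * (suc c * suc c) + 2) * (q * q))
        ≡⟨ ((∀ J ℓ y x → J * (ℓ * y) + 2 * ℓ * (x * y) ≡ (J + 2 * x) * (ℓ * y)) ∋ solve-∀) J ℓ (q * q) (2 * (suc c * suc c) + 2) ⟩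
      E * (ℓ * (q * q))
        ∎
    exponent≤Λ : E * (ℓ * (q * q)) ≤ Λ
    exponent≤Λ = *-cancelˡ-≤ D (begin
      D * (E * (ℓ * (q * q)))    ≡⟨ ((∀ D E x → D * (E * x) ≡ D * E * x) ∋ solve-∀) D E (ℓ * (q * q)) ⟩
      D * E * (ℓ * (q * q))      ≤⟨ *-monoˡ-≤ (ℓ * (q * q)) DE≤ℓ ⟩
      ℓ * (ℓ * (q * q))          ≤⟨ m≤n*m (ℓ * (ℓ * (q * q))) (ℓ ^ 2) {{>-nonZero (1≤ℓ^ 2)}} ⟩
      ℓ ^ 2 * (ℓ * (ℓ * (q * q))) ≡⟨ ((∀ ℓ q → ℓ * (ℓ * 1) * (ℓ * (ℓ * (q * q))) ≡ ℓ * (ℓ * (ℓ * (ℓ * 1))) * (q * q)) ∋ solve-∀) ℓ q ⟩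
      ℓ ^ 4 * (q * q)            ≤⟨ hyp ⟩
      D * Λ                      ∎)

  quotient-bounds : ∀ p σ .{{_ : NonZero σ}} → σ ≤ p → p ≤ suc (p / σ) * σ × suc (p / σ) * σ ≤ 2 * p
  quotient-bounds p σ σ≤p =
    (begin
      p                      ≡⟨ m≡m%n+[m/n]*n p σ ⟩
      p % σ + p / σ * σ      ≤⟨ +-monoˡ-≤ (p / σ * σ) (<⇒≤ (m%n<n p σ)) ⟩
      σ + p / σ * σ          ∎) ,
    (begin
      σ + p / σ * σ          ≤⟨ +-mono-≤ σ≤p (m/n*n≤m p σ) ⟩
      p + p                  ≡⟨ cong (p +_) (+-identityʳ p) ⟨
      2 * p                  ∎)
    where open ≤-Reasoning

  nearby-multiple : ∀ p d .{{_ : NonZero d}} → d ≤ p → ∃ λ τ → 1 ≤ τ × d * τ ≤ p × p ≤ 2 * d * τ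
  nearby-multiple p d d≤p = p / d , 1≤τ , subst (_≤ p) (*-comm (p / d) d) (m/n*n≤m p d) ,
    (begin
      p                      ≡⟨ m≡m%n+[m/n]*n p d ⟩
      p % d + p / d * d      ≤⟨ +-monoˡ-≤ (p / d * d) (<⇒≤ (m%n<n p d)) ⟩
      d + p / d * d          ≤⟨ +-monoˡ-≤ (p / d * d) (m≤n*m d (p / d) {{>-nonZero 1≤τ}}) ⟩
      p / d * d + p / d * d  ≡⟨ ((∀ x d → x * d + x * d ≡ 2 * d * x) ∋ solve-∀) (p / d) d ⟩
      2 * d * (p / d)        ∎)
    where
    open ≤-Reasoning
    1≤τ : 1 ≤ p / d
    1≤τ = m≥n⇒m/n>0 d≤p

open import Defs

-- From subsets of `Fin p` to indicator functions.

module Transfer where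

  open IntegerSums
  open PrimeFields using (PrimeField)
  open import Data.Bool.Base using (Bool; true; false)
  open import Data.Empty using (⊥)
  open import Data.Fin.Base using (Fin; toℕ)
  open import Data.Fin.Subset using (Subset; _∈_; _⊆_; ∣_∣)
  open import Data.Integer hiding (suc; _⊖_; NonZero; ∣_∣)
  open import Data.Integer.Properties
  open import Data.Integer.Tactic.RingSolver using (solve-∀)
  open import Data.Nat.Base as ℕ using (ℕ; suc; zero)
  import Data.Nat.Properties as ℕ
  open import Data.Product.Base using (_×_; _,_)
  open import Data.Sum.Base using (inj₁; inj₂)
  open import Data.Vec.Base using ([]; _∷_; lookup)
  open import Data.Vec.Properties using (lookup⇒[]=; []=⇒lookup)
  open import Function.Base using (_∘_)
  open import Relation.Binary.PropositionalEquality
  open import Relation.Nullary using (contradiction)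

  bit : Bool → ℤ
  bit false = 0ℤ
  bit true  = 1ℤ

  𝟙 : ∀ {p} → Subset p → Fin p → ℤ
  𝟙 S x = bit (lookup S x)

  𝟙∈ : ∀ {p} (S : Subset p) → Bits (𝟙 S)
  𝟙∈ S x with lookup S x
  ... | false = inj₁ refl
  ... | true  = inj₂ refl

  ∈⇒𝟙 : ∀ {p} {S : Subset p} {x} → x ∈ S → 𝟙 S x ≡ 1ℤ
  ∈⇒𝟙 x∈S = cong bit ([]=⇒lookup x∈S)

  𝟙⇒∈ : ∀ {p} (S : Subset p) x → 𝟙 S x ≡ 1ℤ → x ∈ S
  𝟙⇒∈ S x e with lookup S x in eq
  ... | true = lookup⇒[]= x S eq

  𝟙-mono : ∀ {p} (S T : Subset p) {x y} → (x ∈ S → y ∈ T) → 𝟙 S x ≤ 𝟙 T y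
  𝟙-mono S T {x} {y} S⇒T with 𝟙∈ S x
  ... | inj₁ e = subst (_≤ 𝟙 T y) (sym e) (bit-≥0 (𝟙∈ T y))
  ... | inj₂ e = ≤-reflexive (trans e (sym (∈⇒𝟙 (S⇒T (𝟙⇒∈ S x e)))))

  ∑-𝟙 : ∀ {p} (S : Subset p) → ∑ (𝟙 S) ≡ + ∣ S ∣
  ∑-𝟙 []          = refl
  ∑-𝟙 (false ∷ S) = trans (+-identityˡ (∑ (𝟙 S))) (∑-𝟙 S)
  ∑-𝟙 (true ∷ S)  = cong (_+_ 1ℤ) (∑-𝟙 S)

  pos-^ : ∀ a k → (+ a) ^ k ≡ + (a ℕ.^ k)
  pos-^ a zero    = refl
  pos-^ a (suc k) = trans (cong (+ a *_) (pos-^ a k)) (sym (pos-* a (a ℕ.^ k)))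

  square-width : ℕ → ℕ
  square-width M = 3 ℕ.* M ℕ.* (3 ℕ.* M)

  -- 64 M² is (4M)² · 4, from P ≤ 4Mτ squared and from the factor 4 in the upper bound for the
  -- smoothed count; the cube is j³ with j = 3M.
  sample-constant : ℕ → ℕ
  sample-constant M = 64 ℕ.* (M ℕ.* M) ℕ.* (3 ℕ.* M ℕ.* (3 ℕ.* M) ℕ.* (3 ℕ.* M))

  module _ {p} (F : PrimeField p) where

    open PrimeField F
    open Pollard F using (conv)

    residue-shift : ∀ r k → residue (+ (r ℕ.+ k ℕ.* p)) ≡ residue (+ r)
    residue-shift r k = trans (cong residue (trans (pos-+ r (k ℕ.* p)) (cong (_+_ (+ r)) (pos-* k p))))
      (trans (residue-+ (+ r) (+ k * + p)) (trans (cong (residue (+ r) ⊕_)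
        (trans (residue-* (+ k) (+ p)) (cong (residue (+ k) ⊗_) (trans residue-p (sym residue-0)))))
      (solve 2 (λ r k → r :+ k :* con 0ℤ := r) refl (residue (+ r)) (residue (+ k)))))

    AddEq-⊕ : ∀ x y → AddEq p x y (x ⊕ y)
    AddEq-⊕ x y with residue-mod (toℕ x ℕ.+ toℕ y)
    ... | k , e = k , trans e (cong (λ z → toℕ z ℕ.+ k ℕ.* p) (trans (residue-+ (+ toℕ x) (+ toℕ y))
      (cong₂ _⊕_ (residue-toℕ x) (residue-toℕ y))))

    residue-toℕ-* : ∀ x y → residue (+ (toℕ x ℕ.* toℕ y)) ≡ x ⊗ y
    residue-toℕ-* x y = trans (cong residue (pos-* (toℕ x) (toℕ y)))
      (trans (residue-* (+ toℕ x) (+ toℕ y)) (cong₂ _⊗_ (residue-toℕ x) (residue-toℕ y)))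

    MulEq-⊗ : ∀ x y → MulEq p x y (x ⊗ y)
    MulEq-⊗ x y with residue-mod (toℕ x ℕ.* toℕ y)
    ... | k , e = k , trans e (cong (λ z → toℕ z ℕ.+ k ℕ.* p) (residue-toℕ-* x y))

    MulEq⇒⊗ : ∀ {x y z} → MulEq p x y z → x ⊗ y ≡ z
    MulEq⇒⊗ {x} {y} {z} (k , e) = trans (sym (residue-toℕ-* x y))
      (trans (cong (residue ∘ +_) e) (trans (residue-shift (toℕ z) k) (residue-toℕ z)))

    toℕ-𝟎 : toℕ 𝟎 ≡ 0
    toℕ-𝟎 with residue-mod 0
    ... | k , e = trans (cong toℕ (sym residue-0)) (ℕ.m+n≡0⇒m≡0 (toℕ (residue 0ℤ)) (sym e))

    toℕ≡1 : ∀ {o} → toℕ o ≡ 1 → o ≡ 𝟏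
    toℕ≡1 {o} e = trans (sym (residue-toℕ o)) (trans (cong (residue ∘ +_) e) residue-1)

    subgroup-invariant : ∀ Γ → IsMulSubgroup p Γ → ∀ l → 𝟙 Γ l ≡ 1ℤ → l ≢ 𝟎 × (∀ x → 𝟙 Γ (l ⊗ x) ≡ 𝟙 Γ x)
    subgroup-invariant Γ Γ-subgroup l l∈ = l≢0 , λ x → ≤-antisym (𝟙-mono Γ Γ (descend x)) (𝟙-mono Γ Γ (ascend x))
      where
      open IsMulSubgroup Γ-subgroup
      l∈Γ : l ∈ Γ
      l∈Γ = 𝟙⇒∈ Γ l l∈
      l≢0 : l ≢ 𝟎
      l≢0 refl = zero∉ l toℕ-𝟎 l∈Γ
      ascend : ∀ x → x ∈ Γ → l ⊗ x ∈ Γ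
      ascend x x∈Γ = mul∈ l x (l ⊗ x) l∈Γ x∈Γ (MulEq-⊗ l x)
      descend : ∀ x → l ⊗ x ∈ Γ → x ∈ Γ
      descend x lx∈Γ with inv∈ l l∈Γ
      ... | y , y∈Γ , o , o≡1 , ly≡o = subst (_∈ Γ) cancel (mul∈ y (l ⊗ x) _ y∈Γ lx∈Γ (MulEq-⊗ y (l ⊗ x)))
        where
        cancel : y ⊗ (l ⊗ x) ≡ x
        cancel = trans (solve 3 (λ y l x → y :* (l :* x) := l :* y :* x) refl y l x)
          (trans (cong (_⊗ x) (trans (MulEq⇒⊗ ly≡o) (trans (toℕ≡1 o≡1) (sym residue-1))))
          (solve 1 (λ x → con 1ℤ :* x := x) refl x))

    sum-free-conv : ∀ S → SumFree p S → ∀ z → 𝟙 S z * conv (𝟙 S) (𝟙 S) z ≡ 0ℤ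
    sum-free-conv S S-free z = trans (sym (∑-*ˡ (𝟙 S z) (λ x → 𝟙 S x * 𝟙 S (z ⊖ x))))
      (∑-0 λ x → bits-not-all-one (𝟙∈ S z) (𝟙∈ S x) (𝟙∈ S (z ⊖ x)) λ z∈ x∈ z-x∈ →
        S-free (x , z ⊖ x , z , 𝟙⇒∈ S x x∈ , 𝟙⇒∈ S (z ⊖ x) z-x∈ , 𝟙⇒∈ S z z∈ ,
          subst (AddEq p x (z ⊖ x)) (PrimeField.solve F 2 (λ x z → x :+ (z :- x) := z) refl x z) (AddEq-⊕ x (z ⊖ x))))
      where
      bits-not-all-one : ∀ {a b c} → Bit a → Bit b → Bit c → (a ≡ 1ℤ → b ≡ 1ℤ → c ≡ 1ℤ → ⊥) → a * (b * c) ≡ 0ℤ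
      bits-not-all-one {b = b} {c} (inj₁ refl) _ _ _ = *-zeroˡ (b * c)
      bits-not-all-one (inj₂ refl) (inj₁ refl) (inj₁ refl) _ = refl
      bits-not-all-one (inj₂ refl) (inj₁ refl) (inj₂ refl) _ = refl
      bits-not-all-one (inj₂ refl) (inj₂ refl) (inj₁ refl) _ = refl
      bits-not-all-one (inj₂ refl) (inj₂ refl) (inj₂ refl) not = contradiction refl λ e → not e e e

    subset-density : ∀ (Γ S : Subset p) → IsMulSubgroup p Γ → S ⊆ Γ → SumFree p S →
      ∀ (q M τ : ℕ) → 1 ℕ.≤ p → 1 ℕ.≤ M → 1 ℕ.≤ τ → 2 ℕ.* M ℕ.* τ ℕ.≤ p → p ℕ.≤ 2 ℕ.* (2 ℕ.* M) ℕ.* τ →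
      p ℕ.≤ q ℕ.* ∣ S ∣ →
      q ℕ.^ (2 ℕ.* (suc (sample-constant M ℕ.* q) ℕ.* suc (sample-constant M ℕ.* q))) ℕ.* (square-width M ℕ.* (q ℕ.* q)) ℕ.≤ p →
      (M ℕ.+ 3) ℕ.* ∣ Γ ∣ ℕ.≤ 3 ℕ.* M ℕ.* ∣ S ∣ → ⊥
    subset-density Γ S Γ-subgroup S⊆Γ S-free q M τ 1≤p 1≤M 1≤τ 2Mτ≤p p≤4Mτ p≤qσ p-large dense =
      SumFreeDensity.no-dense-sum-free-subset F (𝟙 S) (𝟙 Γ) (𝟙∈ S) (𝟙∈ Γ) (λ x → 𝟙-mono S Γ S⊆Γ)
        (subgroup-invariant Γ Γ-subgroup) (sum-free-conv S S-free) q κ (+ M) (+ τ)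
        (+<+ 1≤p) (+≤+ 1≤M) (+≤+ 1≤τ)
        (subst (_≤ + p) (trans (pos-* (2 ℕ.* M) τ) (cong (_* + τ) (pos-* 2 M))) (+≤+ 2Mτ≤p))
        (subst (+ p ≤_) (trans (pos-* (2 ℕ.* (2 ℕ.* M)) τ) (cong (_* + τ) (trans (pos-* 2 (2 ℕ.* M))
            (trans (cong (+ 2 *_) (pos-* 2 M)) (aux (+ M)))))) (+≤+ p≤4Mτ))
        (subst (+ p ≤_) (trans (pos-* q ∣ S ∣) (cong (+ q *_) (sym (∑-𝟙 S)))) (+≤+ p≤qσ))
        (subst (_< + κ) (trans (pos-* (sample-constant M) q) (cong (_* + q) constant)) (+<+ ℕ.≤-refl))
        (subst (_≤ + p) (trans (pos-* (q ℕ.^ k) (square-width M ℕ.* (q ℕ.* q))) (cong₂ _*_ (sym (pos-^ q k))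
          (trans (pos-* (square-width M) (q ℕ.* q)) (cong₂ _*_ width (pos-* q q))))) (+≤+ p-large))
        (subst₂ _≤_ (trans (pos-* (M ℕ.+ 3) ∣ Γ ∣) (cong₂ _*_ (pos-+ M 3) (sym (∑-𝟙 Γ))))
          (trans (pos-* (3 ℕ.* M) ∣ S ∣) (cong₂ _*_ (pos-* 3 M) (sym (∑-𝟙 S)))) (+≤+ dense))
      where
      κ k : ℕ
      κ = suc (sample-constant M ℕ.* q)
      k = 2 ℕ.* (κ ℕ.* κ)
      aux : ∀ M → + 2 * (+ 2 * M) ≡ + 4 * M
      aux = solve-∀
      width : + square-width M ≡ + 3 * + M * (+ 3 * + M)
      width = trans (pos-* (3 ℕ.* M) (3 ℕ.* M)) (cong₂ _*_ (pos-* 3 M) (pos-* 3 M))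
      constant : + sample-constant M ≡ + 64 * (+ M * + M) * (+ 3 * + M * (+ 3 * + M) * (+ 3 * + M))
      constant = trans (pos-* (64 ℕ.* (M ℕ.* M)) _) (cong₂ _*_
        (trans (pos-* 64 (M ℕ.* M)) (cong (+ 64 *_) (pos-* M M)))
        (trans (pos-* (square-width M) (3 ℕ.* M)) (cong₂ _*_ width (pos-* 3 M))))

-- The choice of parameters and the conclusion.

open import Data.Nat using (ℕ; suc; _+_; _*_; _^_; _≤_)
open import Data.Nat.Primality using (Prime)
open import Data.Fin.Subset using (Subset; _⊆_; ∣_∣)
open import Data.Product using (∃; _,_)
open import Data.Nat.Base using (_<_; s≤s; z≤n; >-nonZero; NonZero)
open import Data.Nat.DivMod using (_/_)
open import Data.Nat.Properties
open import Data.Fin.Subset.Properties using (∣p∣≤n)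
open import Relation.Binary.PropositionalEquality using (_≡_; refl; trans; subst; cong)

-- The o(1) is unwound into an error 1/(m' + 1) valid for all large p. The constant c is (a' +
-- 1)/(b' + 1), and the density hypothesis is squared to remove the root.
theorem10 : (a' b' m' : ℕ) → ∃ λ (P : ℕ) → (p : ℕ) → P ≤ p → Prime p →
    (Γ : Subset p) → IsMulSubgroup p Γ →
    (suc a' ^ 2) * (LL p ^ 4) * (p ^ 2) ≤ (suc b' ^ 2) * (∣ Γ ∣ ^ 2) * L p →
    (S : Subset p) → S ⊆ Γ → SumFree p S →
    3 * suc m' * ∣ S ∣ ≤ (suc m' + 3) * ∣ Γ ∣
-- The first summand makes log log p reach `ℓ₀`; the second gives p ≥ 2M, so that a positive τ with
-- 2Mτ ≤ p exists.
theorem10 a' b' m' = 2 ^ (2 ^ ℓ₀) + 2 * M , bound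
  where
  open Growth
  open Transfer
  M B ℓ₀ : ℕ
  M = suc m'
  B = suc b' ^ 2
  ℓ₀ = threshold (36 * B) (sample-constant M) (square-width M)

  bound : (p : ℕ) → 2 ^ (2 ^ ℓ₀) + 2 * M ≤ p → Prime p →
    (Γ : Subset p) → IsMulSubgroup p Γ →
    (suc a' ^ 2) * (LL p ^ 4) * (p ^ 2) ≤ B * (∣ Γ ∣ ^ 2) * L p →
    (S : Subset p) → S ⊆ Γ → SumFree p S →
    3 * M * ∣ S ∣ ≤ (M + 3) * ∣ Γ ∣
  bound p P≤p p-prime Γ Γ-subgroup Γ-large S S⊆Γ S-free = ≮⇒≥ λ dense →
    let σ = ∣ S ∣
        1≤σ : 1 ≤ σ
        1≤σ = n≢0⇒n>0 λ σ≡0 → n≮0 (subst ((M + 3) * ∣ Γ ∣ <_)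
          (trans (subst (λ t → 3 * M * σ ≡ 3 * M * t) σ≡0 refl) (*-zeroʳ (3 * M))) dense)
        instance
          σ≢0 : NonZero σ
          σ≢0 = >-nonZero 1≤σ
        2^2^ℓ₀≤p = m+n≤o⇒m≤o (2 ^ (2 ^ ℓ₀)) P≤p
        1≤p = ≤-trans (m^n>0 2 (2 ^ ℓ₀)) 2^2^ℓ₀≤p
        -- Rounding p/σ up gives p ≤ qσ, and σ ≤ p keeps qσ within 2p.
        q = suc (p / σ)
        p≤qσ , qσ≤2p = quotient-bounds p σ (∣p∣≤n S)
        τ , 1≤τ , 2Mτ≤p , p≤4Mτ = nearby-multiple p (2 * M) (m+n≤o⇒n≤o (2 ^ (2 ^ ℓ₀)) P≤p)
        n≤3σ : ∣ Γ ∣ ≤ 3 * σ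
        n≤3σ = *-cancelˡ-≤ M (≤-trans (*-monoˡ-≤ ∣ Γ ∣ (m≤m+n M 3))
          (≤-trans (<⇒≤ dense) (≤-reflexive (trans (cong (_* σ) (*-comm 3 M)) (*-assoc M 3 σ)))))
    in subset-density (PrimeFields.primeField p {{>-nonZero 1≤p}} p-prime) Γ S Γ-subgroup S⊆Γ S-free
         q M τ 1≤p (s≤s z≤n) 1≤τ 2Mτ≤p p≤4Mτ p≤qσ
         (p-large (36 * B) (sample-constant M) (square-width M) q p
           (*-mono-≤ {1} {36} (s≤s z≤n) (m^n>0 (suc b') 2)) (s≤s z≤n) 1≤p (LL-≥ 2^2^ℓ₀≤p)
           (index-bound (suc a' ^ 2) B (LL p ^ 4) (L p) p ∣ Γ ∣ σ q (m^n>0 (suc a') 2) 1≤σ qσ≤2p n≤3σ Γ-large))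
         (<⇒≤ dense)
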